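{- The following identity holds: $$\sum_{k=1}^\infty\frac{2^k H_{k-1}^{(2)}}{k\binom{2k}{k}}=\frac{\pi^3}{48}.$$
   Context: For $n=0,1,2,\ldots$, $H_n^{(2)}:=\sum_{0<k\leqslant n}\frac{1}{k^2}$ denotes the second-order harmonic number (so $H_0^{(2)}=0$). -}

module Defs where

open import Data.Bool.Base using (true; false; if_then_else_; T)
open import Data.Integer.Base as ℤ using (+_; +[1+_]; -[1+_]; +0)
import Data.Integer.Properties as ℤ
open import Data.List.Base using (applyUpTo)
open import Data.Nat.Base as ℕ using (ℕ; zero; suc; z≤n; s≤s; NonZero)
open import Data.Nat.Combinatorics using (_C_; nCk≡n!/k![n-k]!; k![n∸k]!∣n!)
open import Data.Nat.Divisibility using (∣⇒≤)
open import Data.Nat.DivMod using (m≥n⇒m/n>0)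
open import Data.Nat.ListAction using (sum)
import Data.Nat.Properties as ℕ
open import Data.Nat.Solver using (module +-*-Solver)
open import Data.Product.Base using (∃-syntax; _×_; _,_; proj₁; proj₂)
open import Data.Rational.Base as ℚ using (ℚ; mkℚ; 0ℚ; 1ℚ; ½; _/_)
import Data.Rational.Properties as ℚ
import Data.Rational.Solver as ℚ-Solver
open import Data.Rational.Unnormalised.Base as ℚᵘ using (mkℚᵘ)
import Data.Rational.Unnormalised.Properties as ℚᵘ
open import Data.Sum.Base using (inj₁; inj₂)
open import Relation.Binary.PropositionalEquality

module RationalLemmas where

  <-by-halves : ∀ {p q} ε → p ℚ.< ½ ℚ.* ε → q ℚ.< ½ ℚ.* ε → p ℚ.+ q ℚ.< ε
  <-by-halves {p} {q} ε p< q< = subst (p ℚ.+ q ℚ.<_) eq (ℚ.+-mono-< p< q<)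
    where
    eq : ½ ℚ.* ε ℚ.+ ½ ℚ.* ε ≡ ε
    eq = trans (sym (ℚ.*-distribʳ-+ ε ½ ½)) (ℚ.*-identityˡ ε)

  half>0 : ∀ {ε} → 0ℚ ℚ.< ε → 0ℚ ℚ.< ½ ℚ.* ε
  half>0 {ε} ε>0 = subst (ℚ._< ½ ℚ.* ε) (ℚ.*-zeroʳ ½) (ℚ.*-monoʳ-<-pos ½ ε>0)

  ∣∣-lub : ∀ {p q} → p ℚ.≤ q → ℚ.- p ℚ.≤ q → ℚ.∣ p ∣ ℚ.≤ q
  ∣∣-lub {p} {q} p≤q -p≤q with ℚ.∣p∣≡p∨∣p∣≡-p p
  ... | inj₁ eq = subst (ℚ._≤ q) (sym eq) p≤q
  ... | inj₂ eq = subst (ℚ._≤ q) (sym eq) -p≤q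

  shift-≤ : ∀ {p q r} → p ℚ.≤ q ℚ.+ r → p ℚ.- r ℚ.≤ q
  shift-≤ {p} {q} {r} p≤ = subst (p ℚ.- r ℚ.≤_) eq (ℚ.+-monoˡ-≤ (ℚ.- r) p≤)
    where
    open ℚ-Solver.+-*-Solver
    eq : (q ℚ.+ r) ℚ.- r ≡ q
    eq = solve 2 (λ q r → (q :+ r) :+ (:- r) := q) refl q r

  ∣-∣-comm : ∀ p q → ℚ.∣ p ℚ.- q ∣ ≡ ℚ.∣ q ℚ.- p ∣
  ∣-∣-comm p q = trans (sym (ℚ.∣-p∣≡∣p∣ (p ℚ.- q)))
    (cong ℚ.∣_∣ (solve 2 (λ p q → :- (p :+ (:- q)) := q :+ (:- p)) refl p q))
    where open ℚ-Solver.+-*-Solver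

  ∣∣-triangle : ∀ p q → ℚ.∣ p ∣ ℚ.≤ ℚ.∣ p ℚ.- q ∣ ℚ.+ ℚ.∣ q ∣
  ∣∣-triangle p q = subst (λ t → ℚ.∣ t ∣ ℚ.≤ ℚ.∣ p ℚ.- q ∣ ℚ.+ ℚ.∣ q ∣)
    (solve 2 (λ p q → (p :+ (:- q)) :+ q := p) refl p q)
    (ℚ.∣p+q∣≤∣p∣+∣q∣ (p ℚ.- q) q)
    where open ℚ-Solver.+-*-Solver

  ∣∣-reverse-triangle : ∀ p q → ℚ.∣ ℚ.∣ p ∣ ℚ.- ℚ.∣ q ∣ ∣ ℚ.≤ ℚ.∣ p ℚ.- q ∣
  ∣∣-reverse-triangle p q = ∣∣-lub
    (shift-≤ (∣∣-triangle p q))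
    (subst (ℚ._≤ ℚ.∣ p ℚ.- q ∣)
      (solve 2 (λ p q → q :+ (:- p) := :- (p :+ (:- q))) refl ℚ.∣ p ∣ ℚ.∣ q ∣)
      (shift-≤ (subst (λ t → ℚ.∣ q ∣ ℚ.≤ t ℚ.+ ℚ.∣ p ∣) (∣-∣-comm q p) (∣∣-triangle q p))))
    where open ℚ-Solver.+-*-Solver

open RationalLemmas

-- Real numbers are Cauchy sequences of rationals, without a prescribed rate
-- of convergence; equality of reals never enters except through limits.

IsCauchy : (ℕ → ℚ) → Set
IsCauchy s = ∀ ε → 0ℚ ℚ.< ε →
  ∃[ N ] (∀ m n → N ℕ.≤ m → N ℕ.≤ n → ℚ.∣ s m ℚ.- s n ∣ ℚ.< ε)

record ℝ : Set where
  constructor mkℝ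
  field
    approx : ℕ → ℚ
    cauchy : IsCauchy approx

open ℝ public

fromℚ : ℚ → ℝ
fromℚ q = mkℝ (λ _ → q) λ ε ε>0 → 0 , λ _ _ _ _ →
  subst (λ t → ℚ.∣ t ∣ ℚ.< ε) (sym (ℚ.+-inverseʳ q)) ε>0

infixl 6 _-_
infixl 7 _*_
infixr 8 _^_
infix  4 _≤_ _⟶_

module RealLemmas where

  subtract-cauchy : ∀ x y → IsCauchy (λ n → approx x n ℚ.- approx y n)
  subtract-cauchy x y ε ε>0
    with cauchy x (½ ℚ.* ε) (half>0 ε>0) | cauchy y (½ ℚ.* ε) (half>0 ε>0)
  ... | M , x-close | N , y-close = M ℕ.⊔ N , λ m n m≥ n≥ →
    ℚ.≤-<-trans (bound (approx x m) (approx x n) (approx y m) (approx y n))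
      (<-by-halves ε
        (x-close m n (ℕ.m⊔n≤o⇒m≤o M N m≥) (ℕ.m⊔n≤o⇒m≤o M N n≥))
        (y-close m n (ℕ.m⊔n≤o⇒n≤o M N m≥) (ℕ.m⊔n≤o⇒n≤o M N n≥)))
    where
    open ℚ-Solver.+-*-Solver
    bound : ∀ a b c d →
      ℚ.∣ (a ℚ.- c) ℚ.- (b ℚ.- d) ∣ ℚ.≤ ℚ.∣ a ℚ.- b ∣ ℚ.+ ℚ.∣ c ℚ.- d ∣
    bound a b c d = subst (λ t → ℚ.∣ t ∣ ℚ.≤ ℚ.∣ a ℚ.- b ∣ ℚ.+ ℚ.∣ c ℚ.- d ∣)
      (solve 4 (λ a b c d → (a :+ (:- b)) :+ (:- (c :+ (:- d)))
                         := (a :+ (:- c)) :+ (:- (b :+ (:- d)))) refl a b c d)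
      (ℚ.∣p-q∣≤∣p∣+∣q∣ (a ℚ.- b) (c ℚ.- d))

  abs-cauchy : ∀ x → IsCauchy (λ n → ℚ.∣ approx x n ∣)
  abs-cauchy x ε ε>0 with cauchy x ε ε>0
  ... | N , x-close = N , λ m n m≥ n≥ →
    ℚ.≤-<-trans (∣∣-reverse-triangle (approx x m) (approx x n)) (x-close m n m≥ n≥)

  0<1 : 0ℚ ℚ.< 1ℚ
  0<1 = ℚ.positive⁻¹ 1ℚ

  eventually-bounded : ∀ x →
    ∃[ N ] ∃[ B ] 0ℚ ℚ.< B × (∀ n → N ℕ.≤ n → ℚ.∣ approx x n ∣ ℚ.≤ B)
  eventually-bounded x with cauchy x 1ℚ 0<1
  ... | N , x-close = N , 1ℚ ℚ.+ ℚ.∣ approx x N ∣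
    , subst (ℚ._< 1ℚ ℚ.+ ℚ.∣ approx x N ∣) (ℚ.+-identityʳ 0ℚ)
        (ℚ.+-mono-<-≤ 0<1 (ℚ.0≤∣p∣ (approx x N)))
    , λ n n≥ → ℚ.≤-trans (∣∣-triangle (approx x n) (approx x N))
        (ℚ.+-monoˡ-≤ ℚ.∣ approx x N ∣ (ℚ.<⇒≤ (x-close n N n≥ ℕ.≤-refl)))

  inverse : ∀ {B} → 0ℚ ℚ.< B → ℚ
  inverse {B} B>0 = (ℚ.1/ B) {{ℚ.pos⇒nonZero B {{ℚ.positive B>0}}}}

  scaled : ∀ {p B t ε} → (B>0 : 0ℚ ℚ.< B) → ℚ.∣ p ∣ ℚ.≤ B → 0ℚ ℚ.≤ t →
    t ℚ.< inverse B>0 ℚ.* ε → ℚ.∣ p ∣ ℚ.* t ℚ.< ε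
  scaled {p} {B} {t} {ε} B>0 p≤B t≥0 t< = ℚ.≤-<-trans
    (ℚ.*-monoʳ-≤-nonNeg t {{ℚ.nonNegative t≥0}} p≤B)
    (subst (B ℚ.* t ℚ.<_) eq (ℚ.*-monoʳ-<-pos B {{ℚ.positive B>0}} t<))
    where
    eq : B ℚ.* (inverse B>0 ℚ.* ε) ≡ ε
    eq = trans (sym (ℚ.*-assoc B (inverse B>0) ε))
           (trans (cong (ℚ._* ε) (ℚ.*-inverseʳ B {{ℚ.pos⇒nonZero B {{ℚ.positive B>0}}}}))
             (ℚ.*-identityˡ ε))

  quotient>0 : ∀ {B ε} → (B>0 : 0ℚ ℚ.< B) → 0ℚ ℚ.< ε → 0ℚ ℚ.< inverse B>0 ℚ.* ε
  quotient>0 {B} {ε} B>0 ε>0 = ℚ.positive⁻¹ _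
    {{ℚ.pos*pos⇒pos (inverse B>0) {{ℚ.1/pos⇒pos B {{ℚ.positive B>0}}}}
                    ε {{ℚ.positive ε>0}}}}

  product-bound : ∀ a b c d → ℚ.∣ a ℚ.* c ℚ.- b ℚ.* d ∣
    ℚ.≤ ℚ.∣ a ∣ ℚ.* ℚ.∣ c ℚ.- d ∣ ℚ.+ ℚ.∣ d ∣ ℚ.* ℚ.∣ a ℚ.- b ∣
  product-bound a b c d = subst₂ ℚ._≤_ (cong ℚ.∣_∣ split)
    (cong₂ ℚ._+_ (ℚ.∣p*q∣≡∣p∣*∣q∣ a (c ℚ.- d)) (ℚ.∣p*q∣≡∣p∣*∣q∣ d (a ℚ.- b)))
    (ℚ.∣p+q∣≤∣p∣+∣q∣ (a ℚ.* (c ℚ.- d)) (d ℚ.* (a ℚ.- b)))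
    where
    open ℚ-Solver.+-*-Solver
    split : a ℚ.* (c ℚ.- d) ℚ.+ d ℚ.* (a ℚ.- b) ≡ a ℚ.* c ℚ.- b ℚ.* d
    split = solve 4 (λ a b c d → a :* (c :+ (:- d)) :+ d :* (a :+ (:- b))
                              := a :* c :+ (:- (b :* d))) refl a b c d

  product-close : ∀ {A B} a b c d ε (A>0 : 0ℚ ℚ.< A) (B>0 : 0ℚ ℚ.< B) →
    ℚ.∣ a ∣ ℚ.≤ A → ℚ.∣ d ∣ ℚ.≤ B →
    ℚ.∣ c ℚ.- d ∣ ℚ.< inverse A>0 ℚ.* (½ ℚ.* ε) →
    ℚ.∣ a ℚ.- b ∣ ℚ.< inverse B>0 ℚ.* (½ ℚ.* ε) →
    ℚ.∣ a ℚ.* c ℚ.- b ℚ.* d ∣ ℚ.< ε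
  product-close a b c d ε A>0 B>0 a≤A d≤B cd ab =
    ℚ.≤-<-trans (product-bound a b c d)
      (<-by-halves {ℚ.∣ a ∣ ℚ.* ℚ.∣ c ℚ.- d ∣} {ℚ.∣ d ∣ ℚ.* ℚ.∣ a ℚ.- b ∣} ε
        (scaled {a} {t = ℚ.∣ c ℚ.- d ∣} {½ ℚ.* ε} A>0 a≤A (ℚ.0≤∣p∣ (c ℚ.- d)) cd)
        (scaled {d} {t = ℚ.∣ a ℚ.- b ∣} {½ ℚ.* ε} B>0 d≤B (ℚ.0≤∣p∣ (a ℚ.- b)) ab))

  multiply-cauchy : ∀ x y → IsCauchy (λ n → approx x n ℚ.* approx y n)
  multiply-cauchy x y ε ε>0 = choose (eventually-bounded x) (eventually-bounded y)
    where
    Goal : Set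
    Goal = ∃[ N ] (∀ m n → N ℕ.≤ m → N ℕ.≤ n →
      ℚ.∣ approx x m ℚ.* approx y m ℚ.- approx x n ℚ.* approx y n ∣ ℚ.< ε)

    Close : ℝ → ℚ → ℕ → Set
    Close z δ N = ∀ m n → N ℕ.≤ m → N ℕ.≤ n → ℚ.∣ approx z m ℚ.- approx z n ∣ ℚ.< δ

    conclude : ∀ M₁ N₁ {A B} (A>0 : 0ℚ ℚ.< A) (B>0 : 0ℚ ℚ.< B) →
      (∀ n → M₁ ℕ.≤ n → ℚ.∣ approx x n ∣ ℚ.≤ A) →
      (∀ n → N₁ ℕ.≤ n → ℚ.∣ approx y n ∣ ℚ.≤ B) →
      ∃[ M ] Close y (inverse A>0 ℚ.* (½ ℚ.* ε)) M →
      ∃[ N ] Close x (inverse B>0 ℚ.* (½ ℚ.* ε)) N →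
      Goal
    conclude M₁ N₁ {A} {B} A>0 B>0 x≤A y≤B (M₂ , y-close) (N₂ , x-close) =
      (M₁ ℕ.⊔ N₁) ℕ.⊔ (M₂ ℕ.⊔ N₂) , λ m n m≥ n≥ →
      product-close {A} {B} (approx x m) (approx x n) (approx y m) (approx y n) ε A>0 B>0
        (x≤A m (ℕ.m⊔n≤o⇒m≤o M₁ N₁ (fst m≥)))
        (y≤B n (ℕ.m⊔n≤o⇒n≤o M₁ N₁ (fst n≥)))
        (y-close m n (ℕ.m⊔n≤o⇒m≤o M₂ N₂ (snd m≥)) (ℕ.m⊔n≤o⇒m≤o M₂ N₂ (snd n≥)))
        (x-close m n (ℕ.m⊔n≤o⇒n≤o M₂ N₂ (snd m≥)) (ℕ.m⊔n≤o⇒n≤o M₂ N₂ (snd n≥)))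
      where
      fst : ∀ {m} → (M₁ ℕ.⊔ N₁) ℕ.⊔ (M₂ ℕ.⊔ N₂) ℕ.≤ m → M₁ ℕ.⊔ N₁ ℕ.≤ m
      fst = ℕ.m⊔n≤o⇒m≤o (M₁ ℕ.⊔ N₁) (M₂ ℕ.⊔ N₂)
      snd : ∀ {m} → (M₁ ℕ.⊔ N₁) ℕ.⊔ (M₂ ℕ.⊔ N₂) ℕ.≤ m → M₂ ℕ.⊔ N₂ ℕ.≤ m
      snd = ℕ.m⊔n≤o⇒n≤o (M₁ ℕ.⊔ N₁) (M₂ ℕ.⊔ N₂)

    choose : ∃[ M ] ∃[ A ] 0ℚ ℚ.< A × (∀ n → M ℕ.≤ n → ℚ.∣ approx x n ∣ ℚ.≤ A) →
             ∃[ N ] ∃[ B ] 0ℚ ℚ.< B × (∀ n → N ℕ.≤ n → ℚ.∣ approx y n ∣ ℚ.≤ B) →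
             Goal
    choose (M₁ , A , A>0 , x≤A) (N₁ , B , B>0 , y≤B) =
      conclude M₁ N₁ {A} {B} A>0 B>0 x≤A y≤B
        (cauchy y (inverse A>0 ℚ.* (½ ℚ.* ε)) (quotient>0 {A} {½ ℚ.* ε} A>0 (half>0 ε>0)))
        (cauchy x (inverse B>0 ℚ.* (½ ℚ.* ε)) (quotient>0 {B} {½ ℚ.* ε} B>0 (half>0 ε>0)))

open RealLemmas

_-_ : ℝ → ℝ → ℝ
x - y = mkℝ (λ n → approx x n ℚ.- approx y n) (subtract-cauchy x y)

_*_ : ℝ → ℝ → ℝ
x * y = mkℝ (λ n → approx x n ℚ.* approx y n) (multiply-cauchy x y)

∣_∣ : ℝ → ℝ
∣ x ∣ = mkℝ (λ n → ℚ.∣ approx x n ∣) (abs-cauchy x)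

_^_ : ℝ → ℕ → ℝ
x ^ zero  = fromℚ 1ℚ
x ^ suc n = x * x ^ n

-- Order of the limits: a termwise comparison may fail by an arbitrarily
-- small amount.
_≤_ : ℝ → ℝ → Set
x ≤ y = ∀ ε → 0ℚ ℚ.< ε → ∃[ N ] (∀ n → N ℕ.≤ n → approx x n ℚ.≤ approx y n ℚ.+ ε)

-- Rational ε suffice, ℚ being dense in ℝ.
_⟶_ : (ℕ → ℝ) → ℝ → Set
s ⟶ x = ∀ ε → 0ℚ ℚ.< ε → ∃[ N ] (∀ n → N ℕ.≤ n → ∣ s n - x ∣ ≤ fromℚ ε)

∑ : ℕ → (ℕ → ℕ) → ℕ
∑ n f = sum (applyUpTo f n)

[_≤?_] : ℕ → ℕ → ℕ
[ a ≤? b ] = if a ℕ.≤ᵇ b then 1 else 0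

-- π is the area of the unit disc x² + y² ≤ 1. Its quarter in the first
-- quadrant is approximated by the squares [i/n, (i+1)/n] × [j/n, (j+1)/n] with
-- 0 ≤ i, j < n: such a square lies in the disc iff its far corner does, and
-- meets the disc iff its near corner does. The two counts differ by at most
-- 2n, so both, divided by n², have a common limit, the area
-- of the quarter disc; innerArea has the factor 4 for the four quadrants.

innerRow outerRow : ℕ → ℕ → ℕ
innerRow n i = ∑ n λ j → [ suc i ℕ.* suc i ℕ.+ suc j ℕ.* suc j ≤? n ℕ.* n ]
outerRow n i = ∑ n λ j → [ i ℕ.* i ℕ.+ j ℕ.* j ≤? n ℕ.* n ]

innerSquares outerSquares : ℕ → ℕ
innerSquares n = ∑ n (innerRow n)
outerSquares n = ∑ n (outerRow n)

innerArea : ∀ n → .{{NonZero n}} → ℚ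
innerArea n = (+ (4 ℕ.* innerSquares n) / (n ℕ.* n)) {{ℕ.m*n≢0 n n}}

module GridLemmas where

  ind-mono : ∀ a b c d → (a ℕ.≤ b → c ℕ.≤ d) → [ a ≤? b ] ℕ.≤ [ c ≤? d ]
  ind-mono a b c d imp with a ℕ.≤ᵇ b in a≤b | c ℕ.≤ᵇ d in c≤d
  ... | false | _     = z≤n
  ... | true  | true  = ℕ.≤-refl
  ... | true  | false with () ← subst T c≤d
    (ℕ.≤⇒≤ᵇ (imp (ℕ.≤ᵇ⇒≤ a b (subst T (sym a≤b) _))))

  ind≤1 : ∀ a b → [ a ≤? b ] ℕ.≤ 1
  ind≤1 a b with a ℕ.≤ᵇ b
  ... | false = z≤n
  ... | true  = ℕ.≤-refl

  ∑-mono : ∀ n {f g} → (∀ i → f i ℕ.≤ g i) → ∑ n f ℕ.≤ ∑ n g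
  ∑-mono zero    f≤g = z≤n
  ∑-mono (suc n) f≤g = ℕ.+-mono-≤ (f≤g 0) (∑-mono n (λ i → f≤g (suc i)))

  ∑-*ˡ : ∀ n c f → ∑ n (λ i → c ℕ.* f i) ≡ c ℕ.* ∑ n f
  ∑-*ˡ zero    c f = sym (ℕ.*-zeroʳ c)
  ∑-*ˡ (suc n) c f = trans (cong (c ℕ.* f 0 ℕ.+_) (∑-*ˡ n c (λ i → f (suc i))))
    (sym (ℕ.*-distribˡ-+ c (f 0) _))

  ∑-1+ : ∀ n f → ∑ n (λ i → suc (f i)) ≡ n ℕ.+ ∑ n f
  ∑-1+ zero    f = refl
  ∑-1+ (suc n) f = cong suc (trans (cong (f 0 ℕ.+_) (∑-1+ n (λ i → f (suc i))))
    (solve 3 (λ a n s → a :+ (n :+ s) := n :+ (a :+ s)) refl (f 0) n _))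
    where open +-*-Solver

  ∑≤n : ∀ n {f} → (∀ i → f i ℕ.≤ 1) → ∑ n f ℕ.≤ n
  ∑≤n zero    f≤1 = z≤n
  ∑≤n (suc n) f≤1 = ℕ.+-mono-≤ (f≤1 0) (∑≤n n (λ i → f≤1 (suc i)))

  ∑-shift : ∀ n f → ∑ n f ℕ.≤ f 0 ℕ.+ ∑ n (λ i → f (suc i))
  ∑-shift zero    f = z≤n
  ∑-shift (suc n) f = ℕ.+-monoʳ-≤ (f 0) (∑-shift n (λ i → f (suc i)))

  ∑-≥const : ∀ m c f → (∀ r → r ℕ.< m → c ℕ.≤ f r) → m ℕ.* c ℕ.≤ ∑ m f
  ∑-≥const zero    c f c≤f = z≤n
  ∑-≥const (suc m) c f c≤f = ℕ.+-mono-≤ (c≤f 0 (s≤s z≤n))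
    (∑-≥const m c _ (λ r r<m → c≤f (suc r) (s≤s r<m)))

  ∑-≤const : ∀ m c f → (∀ r → f r ℕ.≤ c) → ∑ m f ℕ.≤ m ℕ.* c
  ∑-≤const zero    c f f≤c = z≤n
  ∑-≤const (suc m) c f f≤c = ℕ.+-mono-≤ (f≤c 0) (∑-≤const m c _ (λ r → f≤c (suc r)))

  ∑-+ : ∀ a b f → ∑ (a ℕ.+ b) f ≡ ∑ a f ℕ.+ ∑ b (λ i → f (a ℕ.+ i))
  ∑-+ zero    b f = refl
  ∑-+ (suc a) b f = trans (cong (f 0 ℕ.+_) (∑-+ a b (λ i → f (suc i))))
    (sym (ℕ.+-assoc (f 0) _ _))

  blocks-≥ : ∀ m n f g → (∀ i r → r ℕ.< m → g i ℕ.≤ f (i ℕ.* m ℕ.+ r)) →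
    m ℕ.* ∑ n g ℕ.≤ ∑ (n ℕ.* m) f
  blocks-≥ m zero    f g g≤f = ℕ.≤-reflexive (ℕ.*-zeroʳ m)
  blocks-≥ m (suc n) f g g≤f = subst₂ ℕ._≤_
    (sym (ℕ.*-distribˡ-+ m (g 0) _)) (sym (∑-+ m (n ℕ.* m) f))
    (ℕ.+-mono-≤ (∑-≥const m (g 0) f (g≤f 0))
      (blocks-≥ m n _ _ (λ i r r<m → subst (λ t → g (suc i) ℕ.≤ f t)
        (ℕ.+-assoc m (i ℕ.* m) r) (g≤f (suc i) r r<m))))

  blocks-≤ : ∀ m n f g → (∀ i r → f (i ℕ.* m ℕ.+ r) ℕ.≤ g i) →
    ∑ (n ℕ.* m) f ℕ.≤ m ℕ.* ∑ n g
  blocks-≤ m zero    f g f≤g = z≤n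
  blocks-≤ m (suc n) f g f≤g = subst₂ ℕ._≤_
    (sym (∑-+ m (n ℕ.* m) f)) (sym (ℕ.*-distribˡ-+ m (g 0) _))
    (ℕ.+-mono-≤ (∑-≤const m (g 0) f (f≤g 0))
      (blocks-≤ m n _ _ (λ i r → subst (λ t → f t ℕ.≤ g (suc i))
        (ℕ.+-assoc m (i ℕ.* m) r) (f≤g (suc i) r))))

  dilate : ∀ i j m →
    (i ℕ.* m) ℕ.* (i ℕ.* m) ℕ.+ (j ℕ.* m) ℕ.* (j ℕ.* m) ≡ (i ℕ.* i ℕ.+ j ℕ.* j) ℕ.* (m ℕ.* m)
  dilate = solve 3 (λ i j m → (i :* m) :* (i :* m) :+ (j :* m) :* (j :* m)
                           := (i :* i :+ j :* j) :* (m :* m)) refl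
    where open +-*-Solver

  square : ∀ n m → (n ℕ.* m) ℕ.* (n ℕ.* m) ≡ (n ℕ.* n) ℕ.* (m ℕ.* m)
  square = solve 2 (λ n m → (n :* m) :* (n :* m) := (n :* n) :* (m :* m)) refl
    where open +-*-Solver

  sumsq-mono : ∀ {a b c d} → a ℕ.≤ b → c ℕ.≤ d → a ℕ.* a ℕ.+ c ℕ.* c ℕ.≤ b ℕ.* b ℕ.+ d ℕ.* d
  sumsq-mono a≤b c≤d = ℕ.+-mono-≤ (ℕ.*-mono-≤ a≤b a≤b) (ℕ.*-mono-≤ c≤d c≤d)

  far-corner : ∀ i m r → r ℕ.< m → suc (i ℕ.* m ℕ.+ r) ℕ.≤ suc i ℕ.* m
  far-corner i m r r<m = subst₂ ℕ._≤_ (ℕ.+-suc (i ℕ.* m) r) (ℕ.+-comm (i ℕ.* m) m)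
    (ℕ.+-monoʳ-≤ (i ℕ.* m) r<m)

  far near : ℕ → ℕ → ℕ
  far  i j = suc i ℕ.* suc i ℕ.+ suc j ℕ.* suc j
  near i j = i ℕ.* i ℕ.+ j ℕ.* j

  inner-dilate : ∀ n m → m ℕ.* (m ℕ.* innerSquares n) ℕ.≤ innerSquares (n ℕ.* m)
  inner-dilate n m = subst (ℕ._≤ innerSquares (n ℕ.* m))
    (cong (m ℕ.*_) (∑-*ˡ n m (innerRow n)))
    (blocks-≥ m n (innerRow (n ℕ.* m)) (λ i → m ℕ.* innerRow n i) λ i r r<m →
      blocks-≥ m n _ _ λ j s s<m → ind-mono (far i j) (n ℕ.* n)
          (far (i ℕ.* m ℕ.+ r) (j ℕ.* m ℕ.+ s)) ((n ℕ.* m) ℕ.* (n ℕ.* m)) λ le →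
        ℕ.≤-trans (sumsq-mono (far-corner i m r r<m) (far-corner j m s s<m))
          (subst₂ ℕ._≤_ (sym (dilate (suc i) (suc j) m)) (sym (square n m))
            (ℕ.*-monoˡ-≤ (m ℕ.* m) {far i j} {n ℕ.* n} le)))

  outer-dilate : ∀ n m .{{_ : NonZero m}} →
    outerSquares (n ℕ.* m) ℕ.≤ m ℕ.* (m ℕ.* outerSquares n)
  outer-dilate n m = subst (outerSquares (n ℕ.* m) ℕ.≤_)
    (cong (m ℕ.*_) (∑-*ˡ n m (outerRow n)))
    (blocks-≤ m n (outerRow (n ℕ.* m)) (λ i → m ℕ.* outerRow n i) λ i r →
      blocks-≤ m n _ _ λ j s → ind-mono (near (i ℕ.* m ℕ.+ r) (j ℕ.* m ℕ.+ s))
          ((n ℕ.* m) ℕ.* (n ℕ.* m)) (near i j) (n ℕ.* n) λ le →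
        ℕ.*-cancelʳ-≤ (near i j) (n ℕ.* n) (m ℕ.* m) {{ℕ.m*n≢0 m m}}
          (subst₂ ℕ._≤_ (dilate i j m) (square n m)
            (ℕ.≤-trans (sumsq-mono (ℕ.m≤m+n (i ℕ.* m) r) (ℕ.m≤m+n (j ℕ.* m) s)) le)))

  inner≤outer : ∀ n → innerSquares n ℕ.≤ outerSquares n
  inner≤outer n = ∑-mono n λ i → ∑-mono n λ j → ind-mono (far i j) (n ℕ.* n) (near i j) (n ℕ.* n)
    (ℕ.≤-trans (sumsq-mono (ℕ.n≤1+n i) (ℕ.n≤1+n j)))

  outer≤inner : ∀ n → outerSquares n ℕ.≤ n ℕ.+ (n ℕ.+ innerSquares n)
  outer≤inner n = ℕ.≤-trans (∑-shift n (outerRow n))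
    (ℕ.+-mono-≤ (∑≤n n (λ j → ind≤1 (near 0 j) (n ℕ.* n)))
      (subst (∑ n (λ i → outerRow n (suc i)) ℕ.≤_) (∑-1+ n (innerRow n))
        (∑-mono n λ i → ℕ.≤-trans (∑-shift n (λ j → [ near (suc i) j ≤? n ℕ.* n ]))
          (ℕ.+-monoˡ-≤ (innerRow n i) (ind≤1 (near (suc i) 0) (n ℕ.* n))))))

  /-mono : ∀ a b c d .{{_ : NonZero b}} .{{_ : NonZero d}} →
    a ℕ.* d ℕ.≤ c ℕ.* b → + a / b ℚ.≤ + c / d
  /-mono a (suc b) c (suc d) le = ℚ.toℚᵘ-cancel-≤
    (ℚᵘ.≤-respˡ-≃ (ℚᵘ.≃-sym (ℚ.toℚᵘ-fromℚᵘ (mkℚᵘ (+ a) b)))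
      (ℚᵘ.≤-respʳ-≃ (ℚᵘ.≃-sym (ℚ.toℚᵘ-fromℚᵘ (mkℚᵘ (+ c) d)))
        (ℚᵘ.*≤* (subst₂ ℤ._≤_ (ℤ.pos-* a (suc d)) (ℤ.pos-* c (suc b)) (ℤ.+≤+ le)))))

  /-mono-< : ∀ a b c d .{{_ : NonZero b}} .{{_ : NonZero d}} →
    a ℕ.* d ℕ.< c ℕ.* b → + a / b ℚ.< + c / d
  /-mono-< a (suc b) c (suc d) lt = ℚ.toℚᵘ-cancel-<
    (ℚᵘ.<-respˡ-≃ (ℚᵘ.≃-sym (ℚ.toℚᵘ-fromℚᵘ (mkℚᵘ (+ a) b)))
      (ℚᵘ.<-respʳ-≃ (ℚᵘ.≃-sym (ℚ.toℚᵘ-fromℚᵘ (mkℚᵘ (+ c) d)))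
        (ℚᵘ.*<* (subst₂ ℤ._<_ (ℤ.pos-* a (suc d)) (ℤ.pos-* c (suc b)) (ℤ.+<+ lt)))))

  /-+ : ∀ a c b .{{_ : NonZero b}} → + (a ℕ.+ c) / b ≡ + a / b ℚ.+ + c / b
  /-+ a c (suc b) = ℚ.toℚᵘ-injective (ℚᵘ.≃-trans (ℚ.toℚᵘ-fromℚᵘ (mkℚᵘ (+ (a ℕ.+ c)) b))
    (ℚᵘ.≃-sym (ℚᵘ.≃-trans (ℚ.toℚᵘ-homo-+ (+ a / suc b) (+ c / suc b))
      (ℚᵘ.≃-trans (ℚᵘ.+-cong (ℚ.toℚᵘ-fromℚᵘ (mkℚᵘ (+ a) b)) (ℚ.toℚᵘ-fromℚᵘ (mkℚᵘ (+ c) b)))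
        (ℚᵘ.*≡* (trans (cong₂ ℤ._*_
            (trans (cong₂ ℤ._+_ (sym (ℤ.pos-* a (suc b))) (sym (ℤ.pos-* c (suc b))))
              (sym (ℤ.pos-+ (a ℕ.* suc b) (c ℕ.* suc b)))) refl)
          (trans (sym (ℤ.pos-* (a ℕ.* suc b ℕ.+ c ℕ.* suc b) (suc b)))
            (trans (cong +_ (solve 3 (λ a b c → (a :* b :+ c :* b) :* b := (a :+ c) :* (b :* b))
                refl a (suc b) c))
              (ℤ.pos-* (a ℕ.+ c) (suc b ℕ.* suc b)))))))))) 
    where open +-*-Solver

  inner-compare : ∀ n m .{{_ : NonZero n}} .{{_ : NonZero m}} →
    innerSquares m ℕ.* (n ℕ.* n) ℕ.≤ (innerSquares n ℕ.+ 2 ℕ.* n) ℕ.* (m ℕ.* m)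
  inner-compare n m = begin
    innerSquares m ℕ.* (n ℕ.* n)
      ≡⟨ solve 2 (λ s n → s :* (n :* n) := n :* (n :* s)) refl (innerSquares m) n ⟩
    n ℕ.* (n ℕ.* innerSquares m)
      ≤⟨ inner-dilate m n ⟩
    innerSquares (m ℕ.* n)
      ≤⟨ inner≤outer (m ℕ.* n) ⟩
    outerSquares (m ℕ.* n)
      ≡⟨ cong outerSquares (ℕ.*-comm m n) ⟩
    outerSquares (n ℕ.* m)
      ≤⟨ outer-dilate n m ⟩
    m ℕ.* (m ℕ.* outerSquares n)
      ≤⟨ ℕ.*-monoʳ-≤ m (ℕ.*-monoʳ-≤ m (outer≤inner n)) ⟩
    m ℕ.* (m ℕ.* (n ℕ.+ (n ℕ.+ innerSquares n)))
      ≡⟨ solve 3 (λ m n s → m :* (m :* (n :+ (n :+ s))) := (s :+ con 2 :* n) :* (m :* m))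
           refl m n (innerSquares n) ⟩
    (innerSquares n ℕ.+ 2 ℕ.* n) ℕ.* (m ℕ.* m) ∎
    where
    open ℕ.≤-Reasoning
    open +-*-Solver

  innerArea-compare : ∀ n m .{{_ : NonZero n}} .{{_ : NonZero m}} →
    innerArea m ℚ.≤ innerArea n ℚ.+ + 8 / n
  innerArea-compare n m = ℚ.≤-trans
    (/-mono (4 ℕ.* innerSquares m) (m ℕ.* m) (4 ℕ.* innerSquares n ℕ.+ 8 ℕ.* n) (n ℕ.* n) scaled-up)
    (subst (ℚ._≤ innerArea n ℚ.+ + 8 / n)
      (sym (/-+ (4 ℕ.* innerSquares n) (8 ℕ.* n) (n ℕ.* n)))
      (ℚ.+-monoʳ-≤ (innerArea n) (/-mono (8 ℕ.* n) (n ℕ.* n) 8 n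
        (ℕ.≤-reflexive (ℕ.*-assoc 8 n n)))))
    where
    open +-*-Solver
    instance
      _ = ℕ.m*n≢0 n n
      _ = ℕ.m*n≢0 m m
    scaled-up : (4 ℕ.* innerSquares m) ℕ.* (n ℕ.* n)
      ℕ.≤ (4 ℕ.* innerSquares n ℕ.+ 8 ℕ.* n) ℕ.* (m ℕ.* m)
    scaled-up = subst₂ ℕ._≤_ (sym (ℕ.*-assoc 4 (innerSquares m) (n ℕ.* n)))
      (solve 3 (λ s n m → con 4 :* ((s :+ con 2 :* n) :* (m :* m))
                       := (con 4 :* s :+ con 8 :* n) :* (m :* m)) refl (innerSquares n) n m)
      (ℕ.*-monoʳ-≤ 4 (inner-compare n m))

  innerArea-close : ∀ N m n → N ℕ.≤ m → N ℕ.≤ n →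
    ℚ.∣ innerArea (suc m) ℚ.- innerArea (suc n) ∣ ℚ.≤ + 8 / suc N
  innerArea-close N m n m≥ n≥ = ∣∣-lub
    (half-close n m n≥)
    (subst (ℚ._≤ + 8 / suc N)
      (solve 2 (λ p q → q :+ (:- p) := :- (p :+ (:- q))) refl
        (innerArea (suc m)) (innerArea (suc n)))
      (half-close m n m≥))
    where
    open ℚ-Solver.+-*-Solver
    half-close : ∀ k l → N ℕ.≤ k → innerArea (suc l) ℚ.- innerArea (suc k) ℚ.≤ + 8 / suc N
    half-close k l k≥ = ℚ.≤-trans
      (shift-≤ (subst (innerArea (suc l) ℚ.≤_) (ℚ.+-comm (innerArea (suc k)) (+ 8 / suc k))
        (innerArea-compare (suc k) (suc l))))
      (/-mono 8 (suc k) 8 (suc N) (ℕ.*-monoʳ-≤ 8 (s≤s k≥)))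

  archimedean : ∀ ε → 0ℚ ℚ.< ε → ∃[ N ] + 8 / suc N ℚ.< ε
  archimedean ε@(mkℚ +[1+ p ] d _) _ = 8 ℕ.* suc d ,
    subst (+ 8 / suc (8 ℕ.* suc d) ℚ.<_) (ℚ.↥p/↧p≡p ε)
      (/-mono-< 8 (suc (8 ℕ.* suc d)) (suc p) (suc d)
        (ℕ.m≤n*m (suc (8 ℕ.* suc d)) (suc p)))
  archimedean (mkℚ +0       _ _) (ℚ.*<* (ℤ.+<+ ()))
  archimedean (mkℚ -[1+ _ ] _ _) (ℚ.*<* ())

  innerArea-cauchy : IsCauchy (λ n → innerArea (suc n))
  innerArea-cauchy ε ε>0 = proj₁ (archimedean ε ε>0) , λ m n m≥ n≥ →
    ℚ.≤-<-trans (innerArea-close (proj₁ (archimedean ε ε>0)) m n m≥ n≥)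
      (proj₂ (archimedean ε ε>0))

open GridLemmas using (innerArea-cauchy)

π : ℝ
π = mkℝ (λ n → innerArea (suc n)) innerArea-cauchy

∑₁ : (∀ k → .{{NonZero k}} → ℚ) → ℕ → ℚ
∑₁ f zero    = 0ℚ
∑₁ f (suc n) = ∑₁ f n ℚ.+ f (suc n)

HasSum₁ : (∀ k → .{{NonZero k}} → ℚ) → ℝ → Set
HasSum₁ f x = (λ n → fromℚ (∑₁ f n)) ⟶ x

H⁽²⁾ : ℕ → ℚ
H⁽²⁾ = ∑₁ (λ k → (+ 1 / (k ℕ.* k)) {{ℕ.m*n≢0 k k}})

centralBinomial≢0 : ∀ k → NonZero (2 ℕ.* k C k)
centralBinomial≢0 k = ℕ.>-nonZero (subst (0 ℕ.<_) (sym (nCk≡n!/k![n-k]! k≤2k))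
  (m≥n⇒m/n>0 (∣⇒≤ (k![n∸k]!∣n! k≤2k))))
  where
  k≤2k : k ℕ.≤ 2 ℕ.* k
  k≤2k = ℕ.m≤m+n k (k ℕ.+ 0)
  instance
    _ = k ℕ.!* (2 ℕ.* k ℕ.∸ k) !≢0
    _ = (2 ℕ.* k) ℕ.!≢0

term : ∀ k → .{{NonZero k}} → ℚ
term k = (+ (2 ℕ.^ k) / (k ℕ.* (2 ℕ.* k C k))) ℚ.* H⁽²⁾ (ℕ.pred k)
  where instance
    _ = centralBinomial≢0 k
    _ = ℕ.m*n≢0 k (2 ℕ.* k C k)

module Submission where

-- Put θ = arctan t. The series θ₁ = ∑ (4 sin² θ)ᵏ / (k C(2k, k)) cot θ and
-- θ₃ = ∑ H⁽²⁾ₖ₋₁ (4 sin² θ)ᵏ / (k C(2k, k)) cot θ, together with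
-- θ₂ = ∑ (4 sin² θ)ᵏ / (k² C(2k, k)), satisfy dθ₁/dθ = 2, dθ₂/dθ = 2 θ₁ and
-- dθ₃/dθ = 2 θ₂ up to remainders that telescope, already for the partial sums.
-- Hence θ₂ - θ₁²/2 and θ₃ - θ₁ θ₂ + θ₁³/3 vanish in the limit, so that
-- θ₃ = θ₁³/6; at t = 1 the series θ₃ is the one to be summed. That θ₁ = π/2 at
-- t = 1 follows by comparing θ₁ with the area under the points
-- (cos 2θ, sin 2θ), which for t = i/M are lattice points on a circle of radius
-- (2M²)!, so that they cut the disc into whole columns of lattice squares.

open import Data.Integer.Base as ℤ using (+_)
open import Data.Nat.Base as ℕ using (ℕ; zero; suc; _!; NonZero; z≤n; s≤s)
import Data.Integer.Properties as ℤ
import Data.Nat.Properties as ℕ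
open import Data.Nat.Combinatorics using (_C_; nCk+nC[k+1]≡[n+1]C[k+1]; nCk≡nC[n∸k]; nC1≡n; k>n⇒nCk≡0)
open import Data.Nat.Divisibility using (_∣_; ∣-trans; ∣⇒≤; m≤n⇒m!∣n!; m∣m*n)
open import Data.Nat.DivMod using (m/n*n≡m)
import Data.Nat.Tactic.RingSolver as ℕ-solver
open import Data.Product.Base using (∃-syntax; _×_; _,_; proj₁; proj₂)
open import Data.Sum.Base using (inj₁; inj₂)
open import Data.Rational.Base using (_/_)
import Data.Rational.Base as ℚ
import Data.Rational.Properties as ℚ
open import Data.Rational.Unnormalised.Base as ℚᵘ using (mkℚᵘ)
import Data.Rational.Unnormalised.Properties as ℚᵘ
open import Level using (0ℓ)
open import Relation.Binary.PropositionalEquality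
open import Relation.Nullary using (yes; no; contradiction)
open import Relation.Nullary.Decidable using (dec⇒maybe)
open import Tactic.RingSolver using (solve-∀)
open import Tactic.RingSolver.Core.AlmostCommutativeRing
  using (AlmostCommutativeRing; fromCommutativeRing)

open import Defs hiding (_-_; _*_; _^_; _≤_; ∣_∣)

-- Since π is given as a limit of rational square counts, no real angle is ever formed: `t` takes
-- only rational values, cos² θ, sin² θ and sin θ cos θ are rational functions of `t`, and
-- derivatives with respect to `t` carry the factor dθ/dt = cos² θ. The remainders left by sums of
-- length `K` are bounded multiples of `v K t`, whose largest value on [0, 1] is `γ K` = 2ᴷ / C(2K,
-- K), reached at t = 1; it tends to 0. The cubic relation therefore holds for each `K` up to a
-- multiple of `γ K`. On the side of π, `t` is the tangent of half the polar angle 2θ: this makes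
-- the points of the circle rational and lets [0, 1] sweep the whole quarter circle. Clearing the
-- denominators of a whole grid at once leads to the factorial radius. The discretisation error
-- depends on `K`, so the grid is refined for fixed `K`, and only afterwards does `K` grow.

module Estimates where

  open import Data.Rational.Base
    using (ℚ; 0ℚ; 1ℚ; ½; _+_; _*_; _-_; -_; _≤_; _<_; ∣_∣; positive; nonNegative)
  open RationalLemmas
  open RealLemmas
  open GridLemmas

  ℚ-ring : AlmostCommutativeRing 0ℓ 0ℓ
  ℚ-ring = fromCommutativeRing ℚ.+-*-commutativeRing λ x → dec⇒maybe (0ℚ ℚ.≟ x)

  2ℚ 4ℚ : ℚ
  2ℚ = + 2 / 1
  4ℚ = + 4 / 1

  -- Inequalities and absolute values in ℚ

  ≤-by : ∀ {p q d} → 0ℚ ≤ d → q ≡ p + d → p ≤ q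
  ≤-by {p} {q} {d} 0≤d q≡ = subst₂ _≤_ (ℚ.+-identityʳ p) (sym q≡) (ℚ.+-monoʳ-≤ p 0≤d)

  0≤q-p : ∀ {p q} → p ≤ q → 0ℚ ≤ q - p
  0≤q-p {p} {q} p≤q = subst (_≤ q - p) (ℚ.+-inverseʳ p) (ℚ.+-monoˡ-≤ (- p) p≤q)

  0≤1 : 0ℚ ≤ 1ℚ
  0≤1 = ℚ.nonNegative⁻¹ 1ℚ

  0≤2 : 0ℚ ≤ 2ℚ
  0≤2 = ℚ.nonNegative⁻¹ 2ℚ

  +-nonneg : ∀ {p q} → 0ℚ ≤ p → 0ℚ ≤ q → 0ℚ ≤ p + q
  +-nonneg 0≤p 0≤q = ℚ.+-mono-≤ 0≤p 0≤q

  *-mono : ∀ {p q r s} → 0ℚ ≤ p → p ≤ q → 0ℚ ≤ r → r ≤ s → p * r ≤ q * s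
  *-mono {p} {q} {r} {s} 0≤p p≤q 0≤r r≤s = ℚ.≤-trans
    (ℚ.*-monoʳ-≤-nonNeg r {{nonNegative 0≤r}} p≤q)
    (ℚ.*-monoˡ-≤-nonNeg q {{nonNegative (ℚ.≤-trans 0≤p p≤q)}} r≤s)

  *-nonneg : ∀ {p q} → 0ℚ ≤ p → 0ℚ ≤ q → 0ℚ ≤ p * q
  *-nonneg 0≤p 0≤q = *-mono ℚ.≤-refl 0≤p ℚ.≤-refl 0≤q

  p≤∣p∣ : ∀ p → p ≤ ∣ p ∣
  p≤∣p∣ p with ℚ.≤-total 0ℚ p
  ... | inj₁ 0≤p = ℚ.≤-reflexive (sym (ℚ.0≤p⇒∣p∣≡p 0≤p))
  ... | inj₂ p≤0 = ℚ.≤-trans p≤0 (ℚ.0≤∣p∣ p)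

  ∣p∣≤-nonneg : ∀ {p a} → 0ℚ ≤ p → p ≤ a → ∣ p ∣ ≤ a
  ∣p∣≤-nonneg {a = a} 0≤p p≤a = subst (_≤ a) (sym (ℚ.0≤p⇒∣p∣≡p 0≤p)) p≤a

  ∣p+q∣≤ : ∀ {p q a b} → ∣ p ∣ ≤ a → ∣ q ∣ ≤ b → ∣ p + q ∣ ≤ a + b
  ∣p+q∣≤ {p} {q} p≤ q≤ = ℚ.≤-trans (ℚ.∣p+q∣≤∣p∣+∣q∣ p q) (ℚ.+-mono-≤ p≤ q≤)

  ∣p-q∣≤ : ∀ {p q a b} → ∣ p ∣ ≤ a → ∣ q ∣ ≤ b → ∣ p - q ∣ ≤ a + b
  ∣p-q∣≤ {p} {q} p≤ q≤ = ℚ.≤-trans (ℚ.∣p-q∣≤∣p∣+∣q∣ p q) (ℚ.+-mono-≤ p≤ q≤)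

  ∣p*q∣≤ : ∀ {p q a b} → ∣ p ∣ ≤ a → ∣ q ∣ ≤ b → ∣ p * q ∣ ≤ a * b
  ∣p*q∣≤ {p} {q} p≤ q≤ = subst (_≤ _) (sym (ℚ.∣p*q∣≡∣p∣*∣q∣ p q))
    (*-mono (ℚ.0≤∣p∣ p) p≤ (ℚ.0≤∣p∣ q) q≤)

  ≤-limit : ∀ {x y} → (∀ ε → 0ℚ < ε → x ≤ y + ε) → x ≤ y
  ≤-limit {x} {y} x≤y+ with x ℚ.≤? y
  ... | yes x≤y = x≤y
  ... | no  x≰y = contradiction
    (ℚ.<-≤-trans (ℚ.+-monoʳ-< y half<) (subst (_≤ y + ½ * (x - y)) (y+[x-y] x y)
      (x≤y+ (½ * (x - y)) (half>0 0<x-y))))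
    (ℚ.<-irrefl refl)
    where
    y+[x-y] : ∀ x y → x ≡ y + (x - y)
    y+[x-y] = solve-∀ ℚ-ring
    halves : ∀ z → ½ * z + ½ * z ≡ z
    halves = solve-∀ ℚ-ring
    0<x-y : 0ℚ < x - y
    0<x-y = subst (_< x - y) (ℚ.+-inverseʳ y) (ℚ.+-monoˡ-< (- y) (ℚ.≰⇒> x≰y))
    half< : ½ * (x - y) < x - y
    half< = subst₂ _<_ (ℚ.+-identityˡ _) (halves (x - y))
      (ℚ.+-monoˡ-< (½ * (x - y)) (half>0 0<x-y))

  -- Fractions of natural numbers

  ι : ℕ → ℚ
  ι n = + n / 1

  recip : ℕ → ℚ
  recip n = + 1 / suc n

  /-cross : ∀ a b c d .{{_ : NonZero b}} .{{_ : NonZero d}} →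
    a ℕ.* d ≡ c ℕ.* b → + a / b ≡ + c / d
  /-cross a b c d eq = ℚ.≤-antisym
    (/-mono a b c d (ℕ.≤-reflexive eq)) (/-mono c d a b (ℕ.≤-reflexive (sym eq)))

  /-* : ∀ a b c d .{{_ : NonZero b}} .{{_ : NonZero d}} .{{_ : NonZero (b ℕ.* d)}} →
    + a / b * (+ c / d) ≡ + (a ℕ.* c) / (b ℕ.* d)
  /-* a (suc b) c (suc d) = ℚ.toℚᵘ-injective (ℚᵘ.≃-trans (ℚ.toℚᵘ-homo-* (+ a / suc b) (+ c / suc d))
    (ℚᵘ.≃-trans (ℚᵘ.*-cong (ℚ.toℚᵘ-fromℚᵘ (mkℚᵘ (+ a) b)) (ℚ.toℚᵘ-fromℚᵘ (mkℚᵘ (+ c) d)))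
      (ℚᵘ.≃-trans (ℚᵘ.*≡* (cong₂ ℤ._*_ (sym (ℤ.pos-* a c)) refl))
        (ℚᵘ.≃-sym (ℚ.toℚᵘ-fromℚᵘ (mkℚᵘ (+ (a ℕ.* c)) (d ℕ.+ b ℕ.* suc d)))))))

  ι-+ : ∀ m n → ι (m ℕ.+ n) ≡ ι m + ι n
  ι-+ m n = /-+ m n 1

  ι-suc : ∀ n → ι (suc n) ≡ 1ℚ + ι n
  ι-suc n = /-+ 1 n 1

  ι-* : ∀ m n → ι (m ℕ.* n) ≡ ι m * ι n
  ι-* m n = sym (/-* m 1 n 1)

  ι-mono : ∀ {m n} → m ℕ.≤ n → ι m ≤ ι n
  ι-mono {m} {n} m≤n = /-mono m 1 n 1 (ℕ.*-monoˡ-≤ 1 m≤n)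

  0≤ι : ∀ n → 0ℚ ≤ ι n
  0≤ι n = ι-mono {0} {n} z≤n

  /-ι-recip : ∀ a n → + a / suc n ≡ ι a * recip n
  /-ι-recip a n = trans (/-cross a (suc n) (a ℕ.* 1) (1 ℕ.* suc n)
      (trans (cong (a ℕ.*_) (ℕ.*-identityˡ (suc n))) (cong (ℕ._* suc n) (sym (ℕ.*-identityʳ a)))))
    (sym (/-* a 1 1 (suc n)))

  ι-recip : ∀ n → (1ℚ + ι n) * recip n ≡ 1ℚ
  ι-recip n = trans (cong (_* recip n) (sym (ι-suc n)))
    (trans (sym (/-ι-recip (suc n) n)) (/-cross (suc n) (suc n) 1 1 (ℕ.*-comm (suc n) 1)))

  0≤recip : ∀ n → 0ℚ ≤ recip n
  0≤recip n = /-mono 0 1 1 (suc n) z≤n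

  recip-anti : ∀ {m n} → m ℕ.≤ n → recip n ≤ recip m
  recip-anti {m} {n} m≤n = /-mono 1 (suc n) 1 (suc m) (ℕ.*-monoʳ-≤ 1 (s≤s m≤n))

  recip-small : ∀ c ε → 0ℚ < ε → ∃[ N ] (∀ n → N ℕ.≤ n → c * recip n < ε)
  recip-small c ε ε>0 = N , λ n n≥ → ℚ.≤-<-trans
      (*-recip≤ n) (scaled {c} {B} {recip n} {ε} B>0 ∣c∣≤B (0≤recip n)
        (ℚ.≤-<-trans (ℚ.≤-trans (recip-anti n≥) (/-mono 1 (suc N) 8 (suc N) (ℕ.*-monoˡ-≤ (suc N) {1} {8} (s≤s z≤n)))) (proj₂ arch)))
    where
    B : ℚ
    -- The added 1 keeps the bound invertible when c = 0.
    B = ∣ c ∣ + 1ℚ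
    ∣c∣≤B : ∣ c ∣ ≤ B
    ∣c∣≤B = ≤-by 0≤1 refl
    B>0 : 0ℚ < B
    B>0 = ℚ.≤-<-trans (ℚ.0≤∣p∣ c) (subst (_< B) (ℚ.+-identityʳ ∣ c ∣) (ℚ.+-monoʳ-< ∣ c ∣ 0<1))
    arch : ∃[ N ] + 8 / suc N < inverse B>0 * ε
    arch = archimedean (inverse B>0 * ε) (quotient>0 {B} {ε} B>0 ε>0)
    N : ℕ
    N = proj₁ arch
    *-recip≤ : ∀ n → c * recip n ≤ ∣ c ∣ * recip n
    *-recip≤ n = ℚ.*-monoʳ-≤-nonNeg (recip n) {{nonNegative (0≤recip n)}} (p≤∣p∣ c)

  -- Discards errors of order 1/n: neither `x` nor `y` depends on the grid size, so the bound passes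
  -- to the limit.
  ≤-recip-limit : ∀ {x y} c N → (∀ n → N ℕ.≤ n → x ≤ y + c * recip n) → x ≤ y
  ≤-recip-limit {x} {y} c N x≤ = ≤-limit λ ε ε>0 → limit ε (recip-small c ε ε>0)
    where
    limit : ∀ ε → ∃[ M ] (∀ n → M ℕ.≤ n → c * recip n < ε) → x ≤ y + ε
    limit ε (M , small) = ℚ.≤-trans (x≤ (M ℕ.+ N) (ℕ.m≤n+m N M))
      (ℚ.+-monoʳ-≤ y (ℚ.<⇒≤ (small (M ℕ.+ N) (ℕ.m≤m+n M N))))

  small-steps : ∀ (E : ℕ → ℚ) δ N → (∀ i → i ℕ.< N → ∣ E (suc i) - E i ∣ ≤ δ) →
    ∣ E N - E 0 ∣ ≤ ι N * δ
  small-steps E δ zero    step = ℚ.≤-reflexive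
    (trans (cong ∣_∣ (ℚ.+-inverseʳ (E 0))) (sym (ℚ.*-zeroˡ δ)))
  small-steps E δ (suc N) step = subst₂ _≤_ (cong ∣_∣ (split (E (suc N)) (E N) (E 0)))
    (trans (collect δ (ι N)) (cong (_* δ) (sym (ι-suc N))))
    (∣p+q∣≤ (step N ℕ.≤-refl) (small-steps E δ N (λ i i<N → step i (ℕ.m<n⇒m<1+n i<N))))
    where
    split : ∀ a b c → (a - b) + (b - c) ≡ a - c
    split = solve-∀ ℚ-ring
    collect : ∀ d n → d + n * d ≡ (1ℚ + n) * d
    collect = solve-∀ ℚ-ring

  -- Differentiation with uniform quadratic remainders

  Unit : ℚ → Set
  Unit t = 0ℚ ≤ t × t ≤ 1ℚ

  -- The sum t + h may exceed 1, so functions of t + h must be controlled beyond the unit interval;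
  -- for `cos²` this is possible because `cos²∈` holds at every rational.
  Bounded : (ℚ → ℚ → ℚ) → Set
  Bounded φ = ∃[ B ] (∀ t h → Unit t → Unit h → ∣ φ t h ∣ ≤ B)

  bounded-unit : ∀ {φ} → (∀ t h → Unit t → Unit h → Unit (φ t h)) → Bounded φ
  bounded-unit unit = 1ℚ , λ t h t∈ h∈ →
    ∣p∣≤-nonneg (proj₁ (unit t h t∈ h∈)) (proj₂ (unit t h t∈ h∈))

  bounded-const : ∀ c → Bounded (λ _ _ → c)
  bounded-const c = ∣ c ∣ , λ _ _ _ _ → ℚ.≤-refl

  bounded-t : Bounded (λ t _ → t)
  bounded-t = bounded-unit λ _ _ t∈ _ → t∈

  bounded-h : Bounded (λ _ h → h)
  bounded-h = bounded-unit λ _ _ _ h∈ → h∈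

  bounded-+ : ∀ {φ ψ} → Bounded φ → Bounded ψ → Bounded (λ t h → φ t h + ψ t h)
  bounded-+ (B , φ≤) (B′ , ψ≤) = B + B′ , λ t h t∈ h∈ → ∣p+q∣≤ (φ≤ t h t∈ h∈) (ψ≤ t h t∈ h∈)

  bounded-- : ∀ {φ ψ} → Bounded φ → Bounded ψ → Bounded (λ t h → φ t h - ψ t h)
  bounded-- (B , φ≤) (B′ , ψ≤) = B + B′ , λ t h t∈ h∈ → ∣p-q∣≤ (φ≤ t h t∈ h∈) (ψ≤ t h t∈ h∈)

  bounded-* : ∀ {φ ψ} → Bounded φ → Bounded ψ → Bounded (λ t h → φ t h * ψ t h)
  bounded-* {φ} (B , φ≤) (B′ , ψ≤) = B * B′ , λ t h t∈ h∈ →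
    ∣p*q∣≤ {φ t h} (φ≤ t h t∈ h∈) (ψ≤ t h t∈ h∈)

  bounded-cong : ∀ {φ ψ} → (∀ t h → φ t h ≡ ψ t h) → Bounded φ → Bounded ψ
  bounded-cong φ≡ψ (B , φ≤) = B , λ t h t∈ h∈ → subst (λ z → ∣ z ∣ ≤ B) (φ≡ψ t h) (φ≤ t h t∈ h∈)

  -- The remainder is quadratic uniformly in t, so that a mean value inequality
  -- follows by summation over a grid, without completeness of the domain.
  record Diff (f f′ : ℚ → ℚ) : Set where
    field
      rem        : ℚ → ℚ → ℚ
      expand     : ∀ t h → f (t + h) ≡ f t + h * f′ t + h * h * rem t h
      bounded    : Bounded (λ t _ → f t)
      bounded′   : Bounded (λ t _ → f′ t)
      boundedRem : Bounded rem

  open Diff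

  diff-cong : ∀ {f f′ g g′} → (∀ t → f t ≡ g t) → (∀ t → f′ t ≡ g′ t) → Diff f f′ → Diff g g′
  diff-cong f≡g f′≡g′ F .rem = F .rem
  diff-cong f≡g f′≡g′ F .expand t h = trans (sym (f≡g (t + h))) (trans (F .expand t h)
    (cong₂ (λ x y → x + h * y + h * h * F .rem t h) (f≡g t) (f′≡g′ t)))
  diff-cong f≡g f′≡g′ F .bounded    = bounded-cong (λ t _ → f≡g t) (F .bounded)
  diff-cong f≡g f′≡g′ F .bounded′   = bounded-cong (λ t _ → f′≡g′ t) (F .bounded′)
  diff-cong f≡g f′≡g′ F .boundedRem = F .boundedRem

  diff-const : ∀ c → Diff (λ _ → c) (λ _ → 0ℚ)
  diff-const c .rem _ _ = 0ℚ
  diff-const c .expand t h = eq c h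
    where
    eq : ∀ c h → c ≡ c + h * 0ℚ + h * h * 0ℚ
    eq = solve-∀ ℚ-ring
  diff-const c .bounded    = bounded-const c
  diff-const c .bounded′   = bounded-const 0ℚ
  diff-const c .boundedRem = bounded-const 0ℚ

  diff-id : Diff (λ t → t) (λ _ → 1ℚ)
  diff-id .rem _ _ = 0ℚ
  diff-id .expand = eq
    where
    eq : ∀ t h → t + h ≡ t + h * 1ℚ + h * h * 0ℚ
    eq = solve-∀ ℚ-ring
  diff-id .bounded    = bounded-t
  diff-id .bounded′   = bounded-const 1ℚ
  diff-id .boundedRem = bounded-const 0ℚ

  module _ {f f′ g g′} (F : Diff f f′) (G : Diff g g′) where

    diff-+ : Diff (λ t → f t + g t) (λ t → f′ t + g′ t)
    diff-+ .rem t h = F .rem t h + G .rem t h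
    diff-+ .expand t h = trans (cong₂ _+_ (F .expand t h) (G .expand t h))
        (eq (f t) (f′ t) (F .rem t h) (g t) (g′ t) (G .rem t h) h)
      where
      eq : ∀ f f′ r g g′ s h → (f + h * f′ + h * h * r) + (g + h * g′ + h * h * s)
        ≡ (f + g) + h * (f′ + g′) + h * h * (r + s)
      eq = solve-∀ ℚ-ring
    diff-+ .bounded    = bounded-+ (F .bounded) (G .bounded)
    diff-+ .bounded′   = bounded-+ (F .bounded′) (G .bounded′)
    diff-+ .boundedRem = bounded-+ (F .boundedRem) (G .boundedRem)

    diff-* : Diff (λ t → f t * g t) (λ t → f′ t * g t + f t * g′ t)
    diff-* .rem t h = (F .rem t h * g t + f t * G .rem t h + f′ t * g′ t)
      + h * (F .rem t h * g′ t + f′ t * G .rem t h) + h * h * (F .rem t h * G .rem t h)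
    diff-* .expand t h = trans (cong₂ _*_ (F .expand t h) (G .expand t h))
        (eq (f t) (f′ t) (F .rem t h) (g t) (g′ t) (G .rem t h) h)
      where
      eq : ∀ f f′ r g g′ s h → (f + h * f′ + h * h * r) * (g + h * g′ + h * h * s)
        ≡ f * g + h * (f′ * g + f * g′)
          + h * h * ((r * g + f * s + f′ * g′) + h * (r * g′ + f′ * s) + h * h * (r * s))
      eq = solve-∀ ℚ-ring
    diff-* .bounded    = bounded-* (F .bounded) (G .bounded)
    diff-* .bounded′   = bounded-+ (bounded-* (F .bounded′) (G .bounded)) (bounded-* (F .bounded) (G .bounded′))
    diff-* .boundedRem = bounded-+ (bounded-+
        (bounded-+ (bounded-+ (bounded-* (F .boundedRem) (G .bounded)) (bounded-* (F .bounded) (G .boundedRem)))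
          (bounded-* (F .bounded′) (G .bounded′)))
        (bounded-* bounded-h (bounded-+ (bounded-* (F .boundedRem) (G .bounded′)) (bounded-* (F .bounded′) (G .boundedRem)))))
      (bounded-* (bounded-* bounded-h bounded-h) (bounded-* (F .boundedRem) (G .boundedRem)))

  diff-scale : ∀ c {f f′} → Diff f f′ → Diff (λ t → c * f t) (λ t → c * f′ t)
  diff-scale c {f} {f′} F = diff-cong (λ _ → refl) (λ t → eq c (f t) (f′ t)) (diff-* (diff-const c) F)
    where
    eq : ∀ c x y → 0ℚ * x + c * y ≡ c * y
    eq = solve-∀ ℚ-ring

  diff-- : ∀ {f f′ g g′} → Diff f f′ → Diff g g′ → Diff (λ t → f t - g t) (λ t → f′ t - g′ t)
  diff-- {f} {f′} {g} {g′} F G = diff-cong (λ t → neg (f t) (g t)) (λ t → neg (f′ t) (g′ t)) (diff-+ F (diff-scale (- 1ℚ) G))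
    where
    neg : ∀ a b → a + (- 1ℚ) * b ≡ a - b
    neg = solve-∀ ℚ-ring

  grid : ℕ → ℕ → ℚ
  grid m i = ι i * recip m

  grid-0 : ∀ m → grid m 0 ≡ 0ℚ
  grid-0 m = ℚ.*-zeroˡ (recip m)

  grid-suc : ∀ m i → grid m (suc i) ≡ grid m i + recip m
  grid-suc m i = trans (cong (_* recip m) (ι-suc i)) (eq (ι i) (recip m))
    where
    eq : ∀ i r → (1ℚ + i) * r ≡ i * r + r
    eq = solve-∀ ℚ-ring

  grid-end : ∀ m → grid m (suc m) ≡ 1ℚ
  grid-end m = trans (cong (_* recip m) (ι-suc m)) (ι-recip m)

  grid∈ : ∀ m {i} → i ℕ.≤ suc m → Unit (grid m i)
  grid∈ m {i} i≤ = *-nonneg (0≤ι i) (0≤recip m)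
    , subst (grid m i ≤_) (grid-end m) (*-mono (0≤ι i) (ι-mono i≤) (0≤recip m) ℚ.≤-refl)

  recip∈ : ∀ m → Unit (recip m)
  recip∈ m = 0≤recip m , recip-anti {0} {m} z≤n

  -- There are m + 1 steps of width h = 1/(m + 1): the parts linear in h add up to ε, the quadratic
  -- ones only to B h.
  small-grid-steps : ∀ (E : ℕ → ℚ) ε B m →
    (∀ i → i ℕ.< suc m → ∣ E (suc i) - E i ∣ ≤ recip m * ε + recip m * recip m * B) →
    ∣ E (suc m) - E 0 ∣ ≤ ε + B * recip m
  small-grid-steps E ε B m step = subst (∣ E (suc m) - E 0 ∣ ≤_) total (small-steps E _ (suc m) step)
    where
    eq : ∀ n r ε B → n * (r * ε + r * r * B) ≡ (n * r) * (ε + B * r)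
    eq = solve-∀ ℚ-ring
    total : ι (suc m) * (recip m * ε + recip m * recip m * B) ≡ ε + B * recip m
    total = trans (eq (ι (suc m)) (recip m) ε B)
      (trans (cong (_* (ε + B * recip m)) (grid-end m)) (ℚ.*-identityˡ _))

  -- Refining the grid removes the remainder, since its bound `B` is the same for all `m`.
  mean-value : ∀ {f f′} ε → Diff f f′ → (∀ t → Unit t → ∣ f′ t ∣ ≤ ε) → ∣ f 1ℚ - f 0ℚ ∣ ≤ ε
  mean-value {f} {f′} ε F f′≤ε = ≤-recip-limit B 0 λ m _ →
    subst₂ (λ x y → ∣ f x - f y ∣ ≤ ε + B * recip m) (grid-end m) (grid-0 m)
      (small-grid-steps (λ i → f (grid m i)) ε B m λ i i< → step m i (ℕ.<⇒≤ i<))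
    where
    B : ℚ
    B = proj₁ (F .boundedRem)
    eq : ∀ a b c → a + b + c - a ≡ b + c
    eq = solve-∀ ℚ-ring
    step : ∀ m i → i ℕ.≤ suc m → ∣ f (grid m (suc i)) - f (grid m i) ∣ ≤ recip m * ε + recip m * recip m * B
    step m i i≤ = subst (λ z → ∣ z ∣ ≤ recip m * ε + recip m * recip m * B)
      (sym (trans (cong (λ z → f z - f t) (grid-suc m i)) (trans (cong (_- f t) (F .expand t h)) (eq (f t) _ _))))
      (∣p+q∣≤ (∣p*q∣≤ ∣h∣≤ (f′≤ε t t∈)) (∣p*q∣≤ (∣p*q∣≤ ∣h∣≤ ∣h∣≤) (proj₂ (F .boundedRem) t h t∈ (recip∈ m))))
      where
      t h : ℚ
      t = grid m i
      h = recip m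
      t∈ : Unit t
      t∈ = grid∈ m i≤
      ∣h∣≤ : ∣ h ∣ ≤ h
      ∣h∣≤ = ∣p∣≤-nonneg (0≤recip m) ℚ.≤-refl

  -- Trigonometric functions of θ = arctan t

  0≤square : ∀ q → 0ℚ ≤ q * q
  0≤square q with ℚ.≤-total 0ℚ q
  ... | inj₁ 0≤q = *-nonneg 0≤q 0≤q
  ... | inj₂ q≤0 = subst (0ℚ ≤_) (neg² q) (*-nonneg (ℚ.neg-antimono-≤ q≤0) (ℚ.neg-antimono-≤ q≤0))
    where
    neg² : ∀ q → (- q) * (- q) ≡ q * q
    neg² = solve-∀ ℚ-ring

  0<1+t² : ∀ t → 0ℚ < 1ℚ + t * t
  0<1+t² t = ℚ.<-≤-trans 0<1 (≤-by (0≤square t) refl)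

  abstract
    -- Sealed: outside the block this reciprocal is known only through `cos²-inverse` and `0≤cos²`.
    cos² : ℚ → ℚ
    cos² t = inverse (0<1+t² t)

    cos²-inverse : ∀ t → (1ℚ + t * t) * cos² t ≡ 1ℚ
    cos²-inverse t = ℚ.*-inverseʳ (1ℚ + t * t) {{ℚ.pos⇒nonZero (1ℚ + t * t) {{positive (0<1+t² t)}}}}

    0≤cos² : ∀ t → 0ℚ ≤ cos² t
    0≤cos² t = ℚ.<⇒≤ (ℚ.positive⁻¹ _ {{ℚ.1/pos⇒pos (1ℚ + t * t) {{positive (0<1+t² t)}}}})

  sin² : ℚ → ℚ
  sin² t = 1ℚ - cos² t

  sincos : ℚ → ℚ
  sincos t = t * cos² t

  t·sincos : ∀ t → t * sincos t ≡ sin² t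
  t·sincos t = trans (eq t (cos² t)) (cong (_- cos² t) (cos²-inverse t))
    where
    eq : ∀ t c → t * (t * c) ≡ (1ℚ + t * t) * c - c
    eq = solve-∀ ℚ-ring

  sincos² : ∀ t → sincos t * sincos t ≡ cos² t * sin² t
  sincos² t = trans (eq t (cos² t)) (cong (cos² t *_) (t·sincos t))
    where
    eq : ∀ t c → t * c * (t * c) ≡ c * (t * (t * c))
    eq = solve-∀ ℚ-ring

  0≤sin² : ∀ t → 0ℚ ≤ sin² t
  0≤sin² t = subst (0ℚ ≤_) (trans (eq t (cos² t)) (t·sincos t)) (*-nonneg (0≤square t) (0≤cos² t))
    where
    eq : ∀ t c → t * t * c ≡ t * (t * c)
    eq = solve-∀ ℚ-ring

  cos²∈ : ∀ t → Unit (cos² t)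
  cos²∈ t = 0≤cos² t , ≤-by (0≤sin² t) (eq (cos² t))
    where
    eq : ∀ c → 1ℚ ≡ c + (1ℚ - c)
    eq = solve-∀ ℚ-ring

  0≤sincos : ∀ t → Unit t → 0ℚ ≤ sincos t
  0≤sincos t (0≤t , _) = *-nonneg 0≤t (0≤cos² t)

  sincos≤½ : ∀ t → sincos t ≤ ½
  sincos≤½ t = ≤-by {d = ½ * (cos² t * ((1ℚ - t) * (1ℚ - t)))}
    (*-nonneg (ℚ.nonNegative⁻¹ ½) (*-nonneg (0≤cos² t) (0≤square (1ℚ - t))))
    (trans (cong (½ *_) (sym (cos²-inverse t))) (eq t (cos² t)))
    where
    eq : ∀ t c → ½ * ((1ℚ + t * t) * c) ≡ t * c + ½ * (c * ((1ℚ - t) * (1ℚ - t)))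
    eq = solve-∀ ℚ-ring

  -- The gap is ½ cos² θ (1 - t²) = ½ cos 2θ, which is nonnegative because t ≤ 1.
  sin²≤½ : ∀ t → Unit t → sin² t ≤ ½
  sin²≤½ t (0≤t , t≤1) = ≤-by {d = ½ * (cos² t * ((1ℚ - t) * (1ℚ + t)))}
    (*-nonneg (ℚ.nonNegative⁻¹ ½) (*-nonneg (0≤cos² t) (*-nonneg (0≤q-p t≤1) (+-nonneg 0≤1 0≤t))))
    (trans (sym (cong (λ z → z - ½ * z) (cos²-inverse t)))
      (trans (eq t (cos² t)) (cong (_+ ½ * (cos² t * ((1ℚ - t) * (1ℚ + t)))) (t·sincos t))))
    where
    eq : ∀ t c → (1ℚ + t * t) * c - ½ * ((1ℚ + t * t) * c) ≡ t * (t * c) + ½ * (c * ((1ℚ - t) * (1ℚ + t)))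
    eq = solve-∀ ℚ-ring

  sincos-1 : sincos 1ℚ ≡ ½
  sincos-1 = trans (ℚ.*-identityˡ (cos² 1ℚ)) (trans (eq (cos² 1ℚ)) (cong (½ *_) (cos²-inverse 1ℚ)))
    where
    eq : ∀ c → c ≡ ½ * ((1ℚ + 1ℚ * 1ℚ) * c)
    eq = solve-∀ ℚ-ring

  sin²-1 : sin² 1ℚ ≡ ½
  sin²-1 = trans (sym (t·sincos 1ℚ)) (trans (ℚ.*-identityˡ _) sincos-1)

  -- Comparing the two reciprocals gives c⁺ = c - c c⁺ (2th + h²). Substituting this once into
  -- itself, in the term linear in h, leaves the derivative and an explicit remainder.
  cos²-diff : Diff cos² (λ t → - (2ℚ * sincos t * cos² t))
  cos²-diff .rem t h = 2ℚ * t * cos² t * (2ℚ * t + h) * cos² t * cos² (t + h) - cos² t * cos² (t + h)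
  cos²-diff .expand t h = begin
    c⁺                                          ≡⟨ difference ⟩
    c - c * c⁺ * (2ℚ * t * h + h * h)           ≡⟨ eq₁ t h c c⁺ ⟩
    c - h * h * c * c⁺ - 2ℚ * t * h * c * c⁺    ≡⟨ cong (λ z → c - h * h * c * c⁺ - 2ℚ * t * h * c * z) difference ⟩
    c - h * h * c * c⁺ - 2ℚ * t * h * c * (c - c * c⁺ * (2ℚ * t * h + h * h))
                                                ≡⟨ eq₂ t h c c⁺ ⟩
    c + h * - (2ℚ * (t * c) * c) + h * h * (2ℚ * t * c * (2ℚ * t + h) * c * c⁺ - c * c⁺) ∎
    where
    open ≡-Reasoning
    c c⁺ : ℚ
    c = cos² t
    c⁺ = cos² (t + h)
    eq₀ : ∀ t h c c⁺ → (1ℚ + t * t) * c * c⁺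
      ≡ (1ℚ + (t + h) * (t + h)) * c⁺ * c - c * c⁺ * (2ℚ * t * h + h * h)
    eq₀ = solve-∀ ℚ-ring
    eq₁ : ∀ t h c c⁺ → c - c * c⁺ * (2ℚ * t * h + h * h) ≡ c - h * h * c * c⁺ - 2ℚ * t * h * c * c⁺
    eq₁ = solve-∀ ℚ-ring
    eq₂ : ∀ t h c c⁺ → c - h * h * c * c⁺ - 2ℚ * t * h * c * (c - c * c⁺ * (2ℚ * t * h + h * h))
      ≡ c + h * - (2ℚ * (t * c) * c) + h * h * (2ℚ * t * c * (2ℚ * t + h) * c * c⁺ - c * c⁺)
    eq₂ = solve-∀ ℚ-ring
    difference : c⁺ ≡ c - c * c⁺ * (2ℚ * t * h + h * h)
    difference = begin
      c⁺                                                      ≡⟨ ℚ.*-identityˡ c⁺ ⟨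
      1ℚ * c⁺                                                 ≡⟨ cong (_* c⁺) (cos²-inverse t) ⟨
      (1ℚ + t * t) * c * c⁺                                   ≡⟨ eq₀ t h c c⁺ ⟩
      (1ℚ + (t + h) * (t + h)) * c⁺ * c - c * c⁺ * (2ℚ * t * h + h * h)
        ≡⟨ cong (λ z → z * c - c * c⁺ * (2ℚ * t * h + h * h)) (cos²-inverse (t + h)) ⟩
      1ℚ * c - c * c⁺ * (2ℚ * t * h + h * h)                  ≡⟨ cong (_- c * c⁺ * (2ℚ * t * h + h * h)) (ℚ.*-identityˡ c) ⟩
      c - c * c⁺ * (2ℚ * t * h + h * h) ∎
  cos²-diff .bounded  = bounded-unit λ t _ _ _ → cos²∈ t
  cos²-diff .bounded′ = bounded-cong (λ t _ → eq t (cos² t))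
      (bounded-* (bounded-* (bounded-const (- 2ℚ)) (bounded-* bounded-t (cos²-diff .bounded))) (cos²-diff .bounded))
    where
    eq : ∀ t c → - 2ℚ * (t * c) * c ≡ - (2ℚ * (t * c) * c)
    eq = solve-∀ ℚ-ring
  cos²-diff .boundedRem = bounded--
    (bounded-* (bounded-* (bounded-* (bounded-* (bounded-* (bounded-const 2ℚ) bounded-t) bc)
      (bounded-+ (bounded-* (bounded-const 2ℚ) bounded-t) bounded-h)) bc) bc⁺)
    (bounded-* bc bc⁺)
    where
    bc : Bounded (λ t _ → cos² t)
    bc = cos²-diff .bounded
    bc⁺ : Bounded (λ t h → cos² (t + h))
    bc⁺ = bounded-unit λ t h _ _ → cos²∈ (t + h)

  sin²-diff : Diff sin² (λ t → 2ℚ * sincos t * cos² t)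
  sin²-diff = diff-cong (λ _ → refl) (λ t → eq (sincos t) (cos² t)) (diff-- (diff-const 1ℚ) cos²-diff)
    where
    eq : ∀ s c → 0ℚ - (- (2ℚ * s * c)) ≡ 2ℚ * s * c
    eq = solve-∀ ℚ-ring

  sincos-diff : Diff sincos (λ t → cos² t * (1ℚ - 2ℚ * sin² t))
  sincos-diff = diff-cong (λ _ → refl)
      (λ t → trans (eq t (cos² t)) (cong (λ z → cos² t * (1ℚ - 2ℚ * z)) (t·sincos t)))
      (diff-* diff-id cos²-diff)
    where
    eq : ∀ t c → 1ℚ * c + t * - (2ℚ * (t * c) * c) ≡ c * (1ℚ - 2ℚ * (t * (t * c)))
    eq = solve-∀ ℚ-ring

  -- The partial sums and their derivatives

  oddRecip : ℕ → ℚ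
  oddRecip k = recip (2 ℕ.* k)

  oddRecip-inverse : ∀ k → (1ℚ + 2ℚ * ι k) * oddRecip k ≡ 1ℚ
  oddRecip-inverse k = trans (cong (λ z → (1ℚ + z) * oddRecip k) (sym (ι-* 2 k))) (ι-recip (2 ℕ.* k))

  ratio : ℕ → ℚ
  ratio k = 2ℚ * (1ℚ + ι k) * oddRecip k

  -- (4 y)ᵏ / (2k C k)
  power : ℕ → ℚ → ℚ
  power zero    y = 1ℚ
  power (suc k) y = ratio k * y * power k y

  -- The summands of θ₁ and θ₃ are multiples of `w`: one factor sin² θ cot θ has become sin θ cos θ,
  -- so that nothing is divided by zero at t = 0.
  v w : ℕ → ℚ → ℚ
  v k t = power k (sin² t)
  w k t = sincos t * v k t

  -- The exponent rises through the product rule for `w (suc k)`, which is `ratio k` times sin² θ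
  -- times `w k`; the two contributions merge because (sin θ cos θ)² = cos² θ sin² θ.
  w-diff : ∀ k → Diff (w k) (λ t → cos² t * v k t * ((1ℚ + 2ℚ * ι k) - 2ℚ * (1ℚ + ι k) * sin² t))
  w-diff zero = diff-cong (λ t → sym (ℚ.*-identityʳ (sincos t))) (λ t → eq (cos² t) (sin² t)) sincos-diff
    where
    eq : ∀ c y → c * (1ℚ - 2ℚ * y) ≡ c * 1ℚ * ((1ℚ + 2ℚ * 0ℚ) - 2ℚ * (1ℚ + 0ℚ) * y)
    eq = solve-∀ ℚ-ring
  w-diff (suc k) = diff-cong
      (λ t → eq₁ (ratio k) (sin² t) (sincos t) (v k t))
      (λ t → trans (eq₂ (ratio k) (sincos t) (cos² t) (sin² t) (v k t) (ι k))
        (trans (cong (collected (ratio k) (cos² t) (sin² t) (v k t) (ι k)) (sincos² t))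
          (trans (eq₃ (ratio k) (cos² t) (v k t) (ι k))
            (cong (λ i → cos² t * (ratio k * sin² t * v k t) * ((1ℚ + 2ℚ * i) - 2ℚ * (1ℚ + i) * sin² t))
              (sym (ι-suc k))))))
      (diff-scale (ratio k) (diff-* sin²-diff (w-diff k)))
    where
    collected : (r c y v i s² : ℚ) → ℚ
    collected r c y v i s² = r * c * v * (2ℚ * s² + y * ((1ℚ + 2ℚ * i) - 2ℚ * (1ℚ + i) * y))
    eq₁ : ∀ r y s v → r * (y * (s * v)) ≡ s * (r * y * v)
    eq₁ = solve-∀ ℚ-ring
    eq₂ : ∀ r s c y v i →
      r * (2ℚ * s * c * (s * v) + y * (c * v * ((1ℚ + 2ℚ * i) - 2ℚ * (1ℚ + i) * y)))
      ≡ r * c * v * (2ℚ * (s * s) + y * ((1ℚ + 2ℚ * i) - 2ℚ * (1ℚ + i) * y))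
    eq₂ = solve-∀ ℚ-ring
    eq₃ : ∀ r c v i → r * c * v * (2ℚ * (c * (1ℚ - c)) + (1ℚ - c) * ((1ℚ + 2ℚ * i) - 2ℚ * (1ℚ + i) * (1ℚ - c)))
      ≡ c * (r * (1ℚ - c) * v) * ((1ℚ + 2ℚ * (1ℚ + i)) - 2ℚ * (1ℚ + (1ℚ + i)) * (1ℚ - c))
    eq₃ = solve-∀ ℚ-ring

  v-diff : ∀ k → Diff (v (suc k)) (λ t → 2ℚ * (1ℚ + ι k) * ratio k * (cos² t * w k t))
  v-diff zero = diff-cong (λ t → sym (ℚ.*-identityʳ (ratio 0 * sin² t)))
      (λ t → eq (ratio 0) (sincos t) (cos² t)) (diff-scale (ratio 0) sin²-diff)
    where
    eq : ∀ r s c → r * (2ℚ * s * c) ≡ 2ℚ * (1ℚ + 0ℚ) * r * (c * (s * 1ℚ))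
    eq = solve-∀ ℚ-ring
  v-diff (suc k) = diff-cong
      (λ t → sym (ℚ.*-assoc (ratio (suc k)) (sin² t) (v (suc k) t)))
      (λ t → trans (eq (ratio (suc k)) (ratio k) (sincos t) (cos² t) (sin² t) (v k t) (ι k))
        (cong (λ i → 2ℚ * (1ℚ + i) * ratio (suc k) * (cos² t * w (suc k) t)) (sym (ι-suc k))))
      (diff-scale (ratio (suc k)) (diff-* sin²-diff (v-diff k)))
    where
    eq : ∀ r⁺ r s c y v i →
      r⁺ * (2ℚ * s * c * (r * y * v) + y * (2ℚ * (1ℚ + i) * r * (c * (s * v))))
      ≡ 2ℚ * (1ℚ + (1ℚ + i)) * r⁺ * (c * (s * (r * y * v)))
    eq = solve-∀ ℚ-ring

  -- With θ = arctan t, the series θ₁, θ₂ and θ₃ converge to 2 θ, 2 θ² and 4 θ³ / 3.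
  θ₁ θ₂ θ₃ : ℕ → ℚ → ℚ
  θ₁ zero    t = 0ℚ
  θ₁ (suc K) t = θ₁ K t + 2ℚ * oddRecip K * w K t
  θ₂ zero    t = 0ℚ
  θ₂ (suc K) t = θ₂ K t + recip K * recip K * v (suc K) t
  θ₃ zero    t = 0ℚ
  θ₃ (suc K) t = θ₃ K t + H⁽²⁾ K * (2ℚ * oddRecip K * w K t)

  H-suc : ∀ K → H⁽²⁾ (suc K) ≡ H⁽²⁾ K + recip K * recip K
  H-suc K = cong (λ z → H⁽²⁾ K + z) (sym (/-* 1 (suc K) 1 (suc K)))

  -- The source of all telescoping: dividing the bracket in `w-diff` by 2K + 1 turns its two
  -- coefficients into 1 and `ratio K`, and `ratio K` sin² θ takes `v K` to `v (suc K)`.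
  θ-summand-diff : ∀ K → Diff (λ t → 2ℚ * oddRecip K * w K t) (λ t → 2ℚ * cos² t * (v K t - v (suc K) t))
  θ-summand-diff K = diff-cong (λ _ → refl)
      (λ t → trans (eq₁ (oddRecip K) (cos² t) (sin² t) (v K t) (ι K))
        (trans (cong (λ z → 2ℚ * cos² t * (z * v K t - ratio K * sin² t * v K t)) (oddRecip-inverse K))
          (eq₂ (cos² t) (v K t) (v (suc K) t))))
      (diff-scale (2ℚ * oddRecip K) (w-diff K))
    where
    eq₁ : ∀ o c y v i → 2ℚ * o * (c * v * ((1ℚ + 2ℚ * i) - 2ℚ * (1ℚ + i) * y))
      ≡ 2ℚ * c * ((1ℚ + 2ℚ * i) * o * v - 2ℚ * (1ℚ + i) * o * y * v)
    eq₁ = solve-∀ ℚ-ring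
    eq₂ : ∀ c v v⁺ → 2ℚ * c * (1ℚ * v - v⁺) ≡ 2ℚ * c * (v - v⁺)
    eq₂ = solve-∀ ℚ-ring

  θ₁-diff : ∀ K → Diff (θ₁ K) (λ t → 2ℚ * cos² t * (1ℚ - v K t))
  θ₁-diff zero = diff-cong (λ _ → refl) (λ t → eq (cos² t)) (diff-const 0ℚ)
    where
    eq : ∀ c → 0ℚ ≡ 2ℚ * c * (1ℚ - 1ℚ)
    eq = solve-∀ ℚ-ring
  θ₁-diff (suc K) = diff-cong (λ _ → refl) (λ t → eq (cos² t) (v K t) (v (suc K) t))
      (diff-+ (θ₁-diff K) (θ-summand-diff K))
    where
    eq : ∀ c v v⁺ → 2ℚ * c * (1ℚ - v) + 2ℚ * c * (v - v⁺) ≡ 2ℚ * c * (1ℚ - v⁺)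
    eq = solve-∀ ℚ-ring

  -- One factor K + 1 comes from the exponent and one from `ratio K`; together they cancel 1/(K +
  -- 1)², leaving exactly the next summand of θ₁. Hence this derivative has no remainder.
  θ₂-diff : ∀ K → Diff (θ₂ K) (λ t → 2ℚ * cos² t * θ₁ K t)
  θ₂-diff zero = diff-cong (λ _ → refl) (λ t → sym (ℚ.*-zeroʳ (2ℚ * cos² t))) (diff-const 0ℚ)
  θ₂-diff (suc K) = diff-cong (λ _ → refl)
      (λ t → trans (eq₁ (recip K) (oddRecip K) (cos² t) (w K t) (ι K) (θ₁ K t))
        (trans (cong (λ z → 2ℚ * cos² t * (θ₁ K t + 2ℚ * (z * z) * oddRecip K * w K t)) (ι-recip K))
          (eq₂ (oddRecip K) (cos² t) (w K t) (θ₁ K t))))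
      (diff-+ (θ₂-diff K) (diff-scale (recip K * recip K) (v-diff K)))
    where
    eq₁ : ∀ r o c w i a →
      2ℚ * c * a + r * r * (2ℚ * (1ℚ + i) * (2ℚ * (1ℚ + i) * o) * (c * w))
      ≡ 2ℚ * c * (a + 2ℚ * ((1ℚ + i) * r * ((1ℚ + i) * r)) * o * w)
    eq₁ = solve-∀ ℚ-ring
    eq₂ : ∀ o c w a → 2ℚ * c * (a + 2ℚ * (1ℚ * 1ℚ) * o * w) ≡ 2ℚ * c * (a + 2ℚ * o * w)
    eq₂ = solve-∀ ℚ-ring

  -- Summation by parts: the increments of `H⁽²⁾` are the coefficients of θ₂, and the boundary term
  -- is `H⁽²⁾ K * v K t`.
  θ₃-diff : ∀ K → Diff (θ₃ K) (λ t → 2ℚ * cos² t * (θ₂ K t - H⁽²⁾ K * v K t))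
  θ₃-diff zero = diff-cong (λ _ → refl) (λ t → eq (cos² t)) (diff-const 0ℚ)
    where
    eq : ∀ c → 0ℚ ≡ 2ℚ * c * (0ℚ - 0ℚ * 1ℚ)
    eq = solve-∀ ℚ-ring
  θ₃-diff (suc K) = diff-cong (λ _ → refl)
      (λ t → trans (eq (recip K) (H⁽²⁾ K) (cos² t) (v K t) (v (suc K) t) (θ₂ K t))
        (cong (λ z → 2ℚ * cos² t * (θ₂ (suc K) t - z * v (suc K) t)) (sym (H-suc K))))
      (diff-+ (θ₃-diff K) (diff-scale (H⁽²⁾ K) (θ-summand-diff K)))
    where
    eq : ∀ r H c v v⁺ b → 2ℚ * c * (b - H * v) + H * (2ℚ * c * (v - v⁺))
      ≡ 2ℚ * c * ((b + r * r * v⁺) - (H + r * r) * v⁺)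
    eq = solve-∀ ℚ-ring

  -- Bounds uniform in t and in the length of the sums

  γ : ℕ → ℚ
  γ k = power k ½

  0≤oddRecip : ∀ k → 0ℚ ≤ oddRecip k
  0≤oddRecip k = 0≤recip (2 ℕ.* k)

  0≤ratio : ∀ k → 0ℚ ≤ ratio k
  0≤ratio k = *-nonneg (*-nonneg 0≤2 (+-nonneg 0≤1 (0≤ι k))) (0≤oddRecip k)

  0≤power : ∀ k {y} → 0ℚ ≤ y → 0ℚ ≤ power k y
  0≤power zero    0≤y = 0≤1
  0≤power (suc k) 0≤y = *-nonneg (*-nonneg (0≤ratio k) 0≤y) (0≤power k 0≤y)

  power-mono : ∀ k {y z} → 0ℚ ≤ y → y ≤ z → power k y ≤ power k z
  power-mono zero    0≤y y≤z = ℚ.≤-refl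
  power-mono (suc k) 0≤y y≤z = *-mono (*-nonneg (0≤ratio k) 0≤y)
    (*-mono (0≤ratio k) ℚ.≤-refl 0≤y y≤z) (0≤power k 0≤y) (power-mono k 0≤y y≤z)

  0≤v : ∀ k t → 0ℚ ≤ v k t
  0≤v k t = 0≤power k (0≤sin² t)

  v≤γ : ∀ k t → Unit t → v k t ≤ γ k
  v≤γ k t t∈ = power-mono k (0≤sin² t) (sin²≤½ t t∈)

  0≤½ : 0ℚ ≤ ½
  0≤½ = ℚ.nonNegative⁻¹ ½

  0≤γ : ∀ k → 0ℚ ≤ γ k
  0≤γ k = 0≤power k 0≤½

  0≤w : ∀ k t → Unit t → 0ℚ ≤ w k t
  0≤w k t t∈ = *-nonneg (0≤sincos t t∈) (0≤v k t)

  w≤γ/2 : ∀ k t → Unit t → w k t ≤ ½ * γ k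
  w≤γ/2 k t t∈ = *-mono (0≤sincos t t∈) (sincos≤½ t) (0≤v k t) (v≤γ k t t∈)

  γ-suc : ∀ k → γ (suc k) ≡ (1ℚ + ι k) * oddRecip k * γ k
  γ-suc k = eq (ι k) (oddRecip k) (γ k)
    where
    eq : ∀ i o g → 2ℚ * (1ℚ + i) * o * ½ * g ≡ (1ℚ + i) * o * g
    eq = solve-∀ ℚ-ring

  -- γₖ - γₖ₊₁ = k γₖ / (2k + 1), which is at least γₖ / (2k + 1) from k = 1 on.
  γ-decrease : ∀ k → oddRecip (suc k) * γ (suc k) ≤ γ (suc k) - γ (suc (suc k))
  γ-decrease k = ≤-by {d = ι k * (o * g)} (*-nonneg (0≤ι k) (*-nonneg (0≤oddRecip (suc k)) (0≤γ (suc k))))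
    (begin
      g - γ (suc (suc k))                                ≡⟨ cong₂ _-_ (sym (ℚ.*-identityˡ g)) (γ-suc (suc k)) ⟩
      1ℚ * g - (1ℚ + ι (suc k)) * o * g                  ≡⟨ cong (λ z → z * g - (1ℚ + ι (suc k)) * o * g) (sym (oddRecip-inverse (suc k))) ⟩
      (1ℚ + 2ℚ * ι (suc k)) * o * g - (1ℚ + ι (suc k)) * o * g
        ≡⟨ cong (λ i → (1ℚ + 2ℚ * i) * o * g - (1ℚ + i) * o * g) (ι-suc k) ⟩
      (1ℚ + 2ℚ * (1ℚ + ι k)) * o * g - (1ℚ + (1ℚ + ι k)) * o * g
        ≡⟨ eq (ι k) o g ⟩
      o * g + ι k * (o * g) ∎)
    where
    open ≡-Reasoning
    o g : ℚ
    o = oddRecip (suc k)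
    g = γ (suc k)
    eq : ∀ i o g → (1ℚ + 2ℚ * (1ℚ + i)) * o * g - (1ℚ + (1ℚ + i)) * o * g ≡ o * g + i * (o * g)
    eq = solve-∀ ℚ-ring

  -- By `γ-decrease` the increments are dominated by a telescoping sum, whence the sharper bound 2 -
  -- γₖ for k ≥ 1.
  bounded-by-γ : (a : ℕ → ℚ) → a 0 ≡ 0ℚ → (∀ K → a (suc K) ≤ a K + oddRecip K * γ K) → ∀ K → a K ≤ 2ℚ
  bounded-by-γ a a0≡0 step zero    = subst (_≤ 2ℚ) (sym a0≡0) 0≤2
  bounded-by-γ a a0≡0 step (suc K) = ℚ.≤-trans (sharper K) (≤-by (0≤γ (suc K)) (eq (γ (suc K))))
    where
    eq : ∀ g → 2ℚ ≡ 2ℚ - g + g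
    eq = solve-∀ ℚ-ring
    telescope : ∀ g h → 2ℚ - g + (g - h) ≡ 2ℚ - h
    telescope = solve-∀ ℚ-ring
    sharper : ∀ K → a (suc K) ≤ 2ℚ - γ (suc K)
    -- `γ-decrease` starts at index 1; the increment at index 0 is 1, and so is 2 - γ₁.
    sharper zero    = subst (λ z → a 1 ≤ z + oddRecip 0 * γ 0) a0≡0 (step 0)
    sharper (suc K) = ℚ.≤-trans (step (suc K))
      (subst (a (suc K) + oddRecip (suc K) * γ (suc K) ≤_) (telescope (γ (suc K)) (γ (suc (suc K))))
        (ℚ.+-mono-≤ (sharper K) (γ-decrease K)))

  0≤θ₁ : ∀ K t → Unit t → 0ℚ ≤ θ₁ K t
  0≤θ₁ zero    t t∈ = ℚ.≤-refl
  0≤θ₁ (suc K) t t∈ = +-nonneg (0≤θ₁ K t t∈) (*-nonneg (*-nonneg 0≤2 (0≤oddRecip K)) (0≤w K t t∈))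

  θ₁≤2 : ∀ K t → Unit t → θ₁ K t ≤ 2ℚ
  θ₁≤2 K t t∈ = bounded-by-γ (λ K → θ₁ K t) refl
      (λ K → ℚ.+-monoʳ-≤ (θ₁ K t) (subst (2ℚ * oddRecip K * w K t ≤_) (eq (oddRecip K) (γ K))
        (*-mono (*-nonneg 0≤2 (0≤oddRecip K)) ℚ.≤-refl (0≤w K t t∈) (w≤γ/2 K t t∈)))) K
    where
    eq : ∀ o g → 2ℚ * o * (½ * g) ≡ o * g
    eq = solve-∀ ℚ-ring

  0≤θ₂ : ∀ K t → 0ℚ ≤ θ₂ K t
  0≤θ₂ zero    t = ℚ.≤-refl
  0≤θ₂ (suc K) t = +-nonneg (0≤θ₂ K t) (*-nonneg (0≤square (recip K)) (0≤v (suc K) t))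

  θ₂≤2 : ∀ K t → Unit t → θ₂ K t ≤ 2ℚ
  θ₂≤2 K t t∈ = bounded-by-γ (λ K → θ₂ K t) refl (λ K → ℚ.+-monoʳ-≤ (θ₂ K t) (summand K)) K
    where
    eq : ∀ r i o g → r * r * ((1ℚ + i) * o * g) ≡ ((1ℚ + i) * r) * r * (o * g)
    eq = solve-∀ ℚ-ring
    summand : ∀ K → recip K * recip K * v (suc K) t ≤ oddRecip K * γ K
    summand K = begin
      recip K * recip K * v (suc K) t                       ≤⟨ *-mono (0≤square (recip K)) ℚ.≤-refl (0≤v (suc K) t) (v≤γ (suc K) t t∈) ⟩
      recip K * recip K * γ (suc K)                         ≡⟨ cong (recip K * recip K *_) (γ-suc K) ⟩
      recip K * recip K * ((1ℚ + ι K) * oddRecip K * γ K)   ≡⟨ eq (recip K) (ι K) (oddRecip K) (γ K) ⟩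
      ((1ℚ + ι K) * recip K) * recip K * (oddRecip K * γ K) ≡⟨ cong (λ z → z * recip K * (oddRecip K * γ K)) (ι-recip K) ⟩
      1ℚ * recip K * (oddRecip K * γ K)                     ≤⟨ *-mono (*-nonneg 0≤1 (0≤recip K)) (*-mono 0≤1 ℚ.≤-refl (0≤recip K) (proj₂ (recip∈ K))) (*-nonneg (0≤oddRecip K) (0≤γ K)) ℚ.≤-refl ⟩
      1ℚ * 1ℚ * (oddRecip K * γ K)                          ≡⟨ ℚ.*-identityˡ (oddRecip K * γ K) ⟩
      oddRecip K * γ K                                      ∎
      where open ℚ.≤-Reasoning

  0≤H : ∀ K → 0ℚ ≤ H⁽²⁾ K
  0≤H zero    = ℚ.≤-refl
  0≤H (suc K) = subst (0ℚ ≤_) (sym (H-suc K)) (+-nonneg (0≤H K) (0≤square (recip K)))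

  -- 1/(k+1)² ≤ 1/k - 1/(k+1)
  H≤2 : ∀ K → H⁽²⁾ K ≤ 2ℚ
  H≤2 zero    = 0≤2
  H≤2 (suc K) = ℚ.≤-trans (sharper K) (≤-by (0≤recip K) (eq (recip K)))
    where
    eq : ∀ r → 2ℚ ≡ 2ℚ - r + r
    eq = solve-∀ ℚ-ring
    telescope : ∀ g h → 2ℚ - g + (g - h) ≡ 2ℚ - h
    telescope = solve-∀ ℚ-ring
    eq′ : ∀ i r s → (1ℚ + (1ℚ + i)) * s * r - s * ((1ℚ + i) * r) ≡ s * r
    eq′ = solve-∀ ℚ-ring
    difference : ∀ K → recip K - recip (suc K) ≡ recip (suc K) * recip K
    difference K = begin
      recip K - recip (suc K)
        ≡⟨ cong₂ _-_ (sym (ℚ.*-identityˡ (recip K))) (sym (ℚ.*-identityʳ (recip (suc K)))) ⟩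
      1ℚ * recip K - recip (suc K) * 1ℚ
        ≡⟨ cong₂ (λ x y → x * recip K - recip (suc K) * y)
             (sym (trans (cong (λ z → (1ℚ + z) * recip (suc K)) (sym (ι-suc K))) (ι-recip (suc K)))) (sym (ι-recip K)) ⟩
      (1ℚ + (1ℚ + ι K)) * recip (suc K) * recip K - recip (suc K) * ((1ℚ + ι K) * recip K)
        ≡⟨ eq′ (ι K) (recip K) (recip (suc K)) ⟩
      recip (suc K) * recip K ∎
      where open ≡-Reasoning
    sharper : ∀ K → H⁽²⁾ (suc K) ≤ 2ℚ - recip K
    sharper zero    = ℚ.≤-refl
    sharper (suc K) = begin
      H⁽²⁾ (suc (suc K))                               ≡⟨ H-suc (suc K) ⟩
      H⁽²⁾ (suc K) + recip (suc K) * recip (suc K)     ≤⟨ ℚ.+-mono-≤ (sharper K) (*-mono (0≤recip (suc K)) ℚ.≤-refl (0≤recip (suc K)) (recip-anti (ℕ.n≤1+n K))) ⟩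
      2ℚ - recip K + recip (suc K) * recip K           ≡⟨ cong (λ z → 2ℚ - recip K + z) (sym (difference K)) ⟩
      2ℚ - recip K + (recip K - recip (suc K))         ≡⟨ telescope (recip K) (recip (suc K)) ⟩
      2ℚ - recip (suc K)                               ∎
      where open ℚ.≤-Reasoning

  v-0 : ∀ k → v (suc k) 0ℚ ≡ 0ℚ
  v-0 k = trans (cong (λ y → ratio k * y * v k 0ℚ) sin²-0) (eq (ratio k) (v k 0ℚ))
    where
    eq : ∀ r v → r * 0ℚ * v ≡ 0ℚ
    eq = solve-∀ ℚ-ring
    sin²-0 : sin² 0ℚ ≡ 0ℚ
    sin²-0 = trans (sym (t·sincos 0ℚ)) (ℚ.*-zeroˡ (sincos 0ℚ))

  w-0 : ∀ k → w k 0ℚ ≡ 0ℚ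
  w-0 k = trans (cong (_* v k 0ℚ) (ℚ.*-zeroˡ (cos² 0ℚ))) (ℚ.*-zeroˡ (v k 0ℚ))

  θ₁-0 : ∀ K → θ₁ K 0ℚ ≡ 0ℚ
  θ₁-0 zero    = refl
  θ₁-0 (suc K) = trans (cong₂ (λ a b → a + 2ℚ * oddRecip K * b) (θ₁-0 K) (w-0 K)) (eq (2ℚ * oddRecip K))
    where
    eq : ∀ o → 0ℚ + o * 0ℚ ≡ 0ℚ
    eq = solve-∀ ℚ-ring

  θ₂-0 : ∀ K → θ₂ K 0ℚ ≡ 0ℚ
  θ₂-0 zero    = refl
  θ₂-0 (suc K) = trans (cong₂ (λ a b → a + recip K * recip K * b) (θ₂-0 K) (v-0 K)) (eq (recip K * recip K))
    where
    eq : ∀ o → 0ℚ + o * 0ℚ ≡ 0ℚ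
    eq = solve-∀ ℚ-ring

  θ₃-0 : ∀ K → θ₃ K 0ℚ ≡ 0ℚ
  θ₃-0 zero    = refl
  θ₃-0 (suc K) = trans (cong₂ (λ a b → a + H⁽²⁾ K * (2ℚ * oddRecip K * b)) (θ₃-0 K) (w-0 K)) (eq (H⁽²⁾ K) (2ℚ * oddRecip K))
    where
    eq : ∀ H o → 0ℚ + H * (o * 0ℚ) ≡ 0ℚ
    eq = solve-∀ ℚ-ring

  -- The cubic relation at t = 1 with explicit error

  ⅓ ⅙ : ℚ
  ⅓ = + 1 / 3
  ⅙ = + 1 / 6

  1∈ : Unit 1ℚ
  1∈ = 0≤1 , ℚ.≤-refl

  ∣cos²∣≤1 : ∀ t → ∣ cos² t ∣ ≤ 1ℚ
  ∣cos²∣≤1 t = ∣p∣≤-nonneg (proj₁ (cos²∈ t)) (proj₂ (cos²∈ t))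

  module _ (K : ℕ) where

    ∣θ₁∣≤2 : ∀ t → Unit t → ∣ θ₁ K t ∣ ≤ 2ℚ
    ∣θ₁∣≤2 t t∈ = ∣p∣≤-nonneg (0≤θ₁ K t t∈) (θ₁≤2 K t t∈)

    ∣θ₂∣≤2 : ∀ t → Unit t → ∣ θ₂ K t ∣ ≤ 2ℚ
    ∣θ₂∣≤2 t t∈ = ∣p∣≤-nonneg (0≤θ₂ K t) (θ₂≤2 K t t∈)

    ∣v∣≤γ : ∀ t → Unit t → ∣ v K t ∣ ≤ γ K
    ∣v∣≤γ t t∈ = ∣p∣≤-nonneg (0≤v K t) (v≤γ K t t∈)

    -- Built so that everything without a factor `v K` cancels in the derivative. In the cubic case,
    -- subtracting θ₁ θ₂ removes 2 cos² θ · θ₂ at the price of -2 cos² θ · θ₁², which the cube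
    -- compensates.
    square-defect cube-defect : ℚ → ℚ
    square-defect t = θ₂ K t - ½ * (θ₁ K t * θ₁ K t)
    cube-defect t = θ₃ K t - θ₁ K t * θ₂ K t + ⅓ * (θ₁ K t * θ₁ K t * θ₁ K t)

    square-defect-diff : Diff square-defect (λ t → 2ℚ * (cos² t * (θ₁ K t * v K t)))
    square-defect-diff = diff-cong (λ _ → refl) (λ t → eq (cos² t) (v K t) (θ₁ K t))
        (diff-- (θ₂-diff K) (diff-scale ½ (diff-* (θ₁-diff K) (θ₁-diff K))))
      where
      eq : ∀ c v a → 2ℚ * c * a - ½ * (2ℚ * c * (1ℚ - v) * a + a * (2ℚ * c * (1ℚ - v)))
        ≡ 2ℚ * (c * (a * v))
      eq = solve-∀ ℚ-ring

    cube-defect-diff : Diff cube-defect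
      (λ t → 2ℚ * (cos² t * (v K t * (θ₂ K t - H⁽²⁾ K - θ₁ K t * θ₁ K t))))
    cube-defect-diff = diff-cong (λ _ → refl) (λ t → eq (cos² t) (v K t) (θ₁ K t) (θ₂ K t) (H⁽²⁾ K))
        (diff-+ (diff-- (θ₃-diff K) (diff-* (θ₁-diff K) (θ₂-diff K)))
          (diff-scale ⅓ (diff-* (diff-* (θ₁-diff K) (θ₁-diff K)) (θ₁-diff K))))
      where
      eq : ∀ c v a b H →
        2ℚ * c * (b - H * v) - (2ℚ * c * (1ℚ - v) * b + a * (2ℚ * c * a))
          + ⅓ * ((2ℚ * c * (1ℚ - v) * a + a * (2ℚ * c * (1ℚ - v))) * a + a * a * (2ℚ * c * (1ℚ - v)))
        ≡ 2ℚ * (c * (v * (b - H - a * a)))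
      eq = solve-∀ ℚ-ring

    vanishing : ∀ {f : ℚ → ℚ} → f 0ℚ ≡ 0ℚ → ∀ {ε} → ∣ f 1ℚ - f 0ℚ ∣ ≤ ε → ∣ f 1ℚ ∣ ≤ ε
    vanishing {f} f0≡0 {ε} = subst (λ z → ∣ z ∣ ≤ ε) (trans (cong (λ z → f 1ℚ - z) f0≡0) (eq (f 1ℚ)))
      where
      eq : ∀ a → a - 0ℚ ≡ a
      eq = solve-∀ ℚ-ring

    square-defect-1 : ∣ square-defect 1ℚ ∣ ≤ 2ℚ * (1ℚ * (2ℚ * γ K))
    square-defect-1 = vanishing {square-defect} (cong₂ (λ a b → b - ½ * (a * a)) (θ₁-0 K) (θ₂-0 K))
      (mean-value _ square-defect-diff λ t t∈ →
        ∣p*q∣≤ {2ℚ} ℚ.≤-refl (∣p*q∣≤ {cos² t} (∣cos²∣≤1 t) (∣p*q∣≤ {θ₁ K t} (∣θ₁∣≤2 t t∈) (∣v∣≤γ t t∈))))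

    cube-defect-1 : ∣ cube-defect 1ℚ ∣ ≤ 2ℚ * (1ℚ * (γ K * (2ℚ + 2ℚ + 2ℚ * 2ℚ)))
    cube-defect-1 = vanishing {cube-defect} (trans
        (cong₂ (λ a b → θ₃ K 0ℚ - a * b + ⅓ * (a * a * a)) (θ₁-0 K) (θ₂-0 K))
        (cong (λ c → c - 0ℚ * 0ℚ + ⅓ * (0ℚ * 0ℚ * 0ℚ)) (θ₃-0 K)))
      (mean-value _ cube-defect-diff λ t t∈ →
        ∣p*q∣≤ {2ℚ} ℚ.≤-refl (∣p*q∣≤ {cos² t} (∣cos²∣≤1 t) (∣p*q∣≤ {v K t} (∣v∣≤γ t t∈)
          (∣p-q∣≤ {θ₂ K t - H⁽²⁾ K} (∣p-q∣≤ {θ₂ K t} (∣θ₂∣≤2 t t∈) (∣p∣≤-nonneg (0≤H K) (H≤2 K)))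
            (∣p*q∣≤ {θ₁ K t} (∣θ₁∣≤2 t t∈) (∣θ₁∣≤2 t t∈))))))

    -- Adding θ₁ times the square defect to the cube defect eliminates θ₂. The errors are 16 `γ K`
    -- from the cube and 2 · 4 `γ K` from the square.
    θ₃≈θ₁³/6 : ∣ θ₃ K 1ℚ - ⅙ * (θ₁ K 1ℚ * θ₁ K 1ℚ * θ₁ K 1ℚ) ∣ ≤ ι 24 * γ K
    θ₃≈θ₁³/6 = subst₂ (λ x y → ∣ x ∣ ≤ y) (eq (θ₁ K 1ℚ) (θ₂ K 1ℚ) (θ₃ K 1ℚ)) (total (γ K))
        (∣p+q∣≤ {cube-defect 1ℚ} cube-defect-1 (∣p*q∣≤ {θ₁ K 1ℚ} (∣θ₁∣≤2 1ℚ 1∈) square-defect-1))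
      where
      eq : ∀ a b c → c - a * b + ⅓ * (a * a * a) + a * (b - ½ * (a * a)) ≡ c - ⅙ * (a * a * a)
      eq = solve-∀ ℚ-ring
      total : ∀ g → 2ℚ * (1ℚ * (g * (2ℚ + 2ℚ + 2ℚ * 2ℚ))) + 2ℚ * (2ℚ * (1ℚ * (2ℚ * g))) ≡ ι 24 * g
      total = solve-∀ ℚ-ring

  -- (k + 2) γₖ₊₁ / ((k + 1) γₖ) = (k + 2) / (2 k + 1), which is at most 1 from k = 1 on.
  γ≤ : ∀ k → γ k ≤ 2ℚ * recip k
  γ≤ k = subst (_≤ 2ℚ * recip k)
      (trans (eq (ι k) (recip k) (γ k)) (trans (cong (_* γ k) (ι-recip k)) (ℚ.*-identityˡ (γ k))))
      (*-mono (*-nonneg (+-nonneg 0≤1 (0≤ι k)) (0≤γ k)) (product k) (0≤recip k) ℚ.≤-refl)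
    where
    eq : ∀ i r g → (1ℚ + i) * g * r ≡ (1ℚ + i) * r * g
    eq = solve-∀ ℚ-ring
    eq₂ : ∀ i o g → (1ℚ + (1ℚ + i)) * ((1ℚ + 2ℚ * (1ℚ + i)) * o * g)
      ≡ (1ℚ + (1ℚ + (1ℚ + i))) * ((1ℚ + (1ℚ + i)) * o * g) + i * ((1ℚ + (1ℚ + i)) * o * g)
    eq₂ = solve-∀ ℚ-ring
    decrease : ∀ k → (1ℚ + ι (suc (suc k))) * γ (suc (suc k)) ≤ (1ℚ + ι (suc k)) * γ (suc k)
    decrease k = ≤-by
      (*-nonneg (0≤ι k) (*-nonneg (*-nonneg (+-nonneg 0≤1 (+-nonneg 0≤1 (0≤ι k))) (0≤oddRecip (suc k))) (0≤γ (suc k))))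
      (begin
        (1ℚ + ι (suc k)) * g
          ≡⟨ cong₂ (λ i z → (1ℚ + i) * z) (ι-suc k) (sym (ℚ.*-identityˡ g)) ⟩
        (1ℚ + (1ℚ + ι k)) * (1ℚ * g)
          ≡⟨ cong (λ z → (1ℚ + (1ℚ + ι k)) * (z * g)) (trans (sym (oddRecip-inverse (suc k)))
               (cong (λ i → (1ℚ + 2ℚ * i) * o) (ι-suc k))) ⟩
        (1ℚ + (1ℚ + ι k)) * ((1ℚ + 2ℚ * (1ℚ + ι k)) * o * g)
          ≡⟨ eq₂ (ι k) o g ⟩
        (1ℚ + (1ℚ + (1ℚ + ι k))) * ((1ℚ + (1ℚ + ι k)) * o * g) + ι k * ((1ℚ + (1ℚ + ι k)) * o * g)
          ≡⟨ cong (_+ ι k * ((1ℚ + (1ℚ + ι k)) * o * g)) (sym (cong₂ (λ i z → (1ℚ + i) * z)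
               (trans (ι-suc (suc k)) (cong (λ i → 1ℚ + i) (ι-suc k)))
               (trans (γ-suc (suc k)) (cong (λ i → (1ℚ + i) * o * g) (ι-suc k))))) ⟩
        (1ℚ + ι (suc (suc k))) * γ (suc (suc k)) + ι k * ((1ℚ + (1ℚ + ι k)) * o * g) ∎)
      where
      open ≡-Reasoning
      o g : ℚ
      o = oddRecip (suc k)
      g = γ (suc k)
    product : ∀ k → (1ℚ + ι k) * γ k ≤ 2ℚ
    product zero          = ≤-by 0≤1 refl
    product (suc zero)    = ℚ.≤-refl
    product (suc (suc k)) = ℚ.≤-trans (decrease k) (product (suc k))

  -- Central binomial coefficients

  absorption : ∀ n k → suc k ℕ.* (suc n C suc k) ≡ suc n ℕ.* (n C k)
  absorption n zero = trans (ℕ.*-identityˡ (suc n C 1)) (trans (nC1≡n (suc n)) (sym (ℕ.*-identityʳ (suc n))))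
  absorption zero    (suc k) = trans (cong (suc (suc k) ℕ.*_) (k>n⇒nCk≡0 {1} {suc (suc k)} (s≤s (s≤s z≤n)))) (ℕ.*-zeroʳ (suc (suc k)))
  absorption (suc n) (suc k) = begin
    suc (suc k) ℕ.* (suc (suc n) C suc (suc k))
      ≡⟨ cong (suc (suc k) ℕ.*_) (sym (nCk+nC[k+1]≡[n+1]C[k+1] (suc n) (suc k))) ⟩
    suc (suc k) ℕ.* (a ℕ.+ (suc n C suc (suc k)))
      ≡⟨ eq₁ k a (suc n C suc (suc k)) ⟩
    a ℕ.+ (suc k ℕ.* a ℕ.+ suc (suc k) ℕ.* (suc n C suc (suc k)))
      ≡⟨ cong₂ (λ x y → a ℕ.+ (x ℕ.+ y)) (absorption n k) (absorption n (suc k)) ⟩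
    a ℕ.+ (suc n ℕ.* (n C k) ℕ.+ suc n ℕ.* (n C suc k))
      ≡⟨ cong (a ℕ.+_) (trans (sym (ℕ.*-distribˡ-+ (suc n) (n C k) (n C suc k)))
           (cong (suc n ℕ.*_) (nCk+nC[k+1]≡[n+1]C[k+1] n k))) ⟩
    suc (suc n) ℕ.* a ∎
    where
    open ≡-Reasoning
    a : ℕ
    a = suc n C suc k
    eq₁ : ∀ k a b → suc (suc k) ℕ.* (a ℕ.+ b) ≡ a ℕ.+ (suc k ℕ.* a ℕ.+ suc (suc k) ℕ.* b)
    eq₁ = ℕ-solver.solve-∀

  -- Absorption is applied in rows 2k + 2 and 2k + 1; the symmetry of row 2k + 1 joins the two.
  centralBinomial-suc : ∀ k → suc k ℕ.* (2 ℕ.* suc k C suc k) ≡ 2 ℕ.* (suc (2 ℕ.* k) ℕ.* (2 ℕ.* k C k))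
  centralBinomial-suc k = begin
    suc k ℕ.* (2 ℕ.* suc k C suc k)                ≡⟨ cong (λ n → suc k ℕ.* (n C suc k)) (ℕ.*-suc 2 k) ⟩
    suc k ℕ.* (suc (suc (2 ℕ.* k)) C suc k)        ≡⟨ absorption (suc (2 ℕ.* k)) k ⟩
    suc (suc (2 ℕ.* k)) ℕ.* (suc (2 ℕ.* k) C k)    ≡⟨ cong₂ ℕ._*_ (sym (ℕ.*-suc 2 k)) symmetric ⟩
    2 ℕ.* suc k ℕ.* (suc (2 ℕ.* k) C suc k)        ≡⟨ ℕ.*-assoc 2 (suc k) _ ⟩
    2 ℕ.* (suc k ℕ.* (suc (2 ℕ.* k) C suc k))      ≡⟨ cong (2 ℕ.*_) (absorption (2 ℕ.* k) k) ⟩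
    2 ℕ.* (suc (2 ℕ.* k) ℕ.* (2 ℕ.* k C k))        ∎
    where
    open ≡-Reasoning
    double : ∀ k → suc (2 ℕ.* k) ≡ suc k ℕ.+ k
    double = ℕ-solver.solve-∀
    symmetric : suc (2 ℕ.* k) C k ≡ suc (2 ℕ.* k) C suc k
    symmetric = trans (nCk≡nC[n∸k] (ℕ.m≤n⇒m≤1+n (ℕ.m≤m+n k (k ℕ.+ 0))))
      (cong (suc (2 ℕ.* k) C_) (trans (cong (ℕ._∸ k) (double k)) (ℕ.m+n∸n≡m (suc k) k)))

  module _ (k : ℕ) where

    private instance
      C≢0 : NonZero (2 ℕ.* k C k)
      C≢0 = centralBinomial≢0 k
      C⁺≢0 : NonZero (2 ℕ.* suc k C suc k)
      C⁺≢0 = centralBinomial≢0 (suc k)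
      kC⁺≢0 : NonZero (suc k ℕ.* (2 ℕ.* suc k C suc k))
      kC⁺≢0 = ℕ.m*n≢0 (suc k) (2 ℕ.* suc k C suc k)
      oC≢0 : NonZero (suc (2 ℕ.* k) ℕ.* (2 ℕ.* k C k))
      oC≢0 = ℕ.m*n≢0 (suc (2 ℕ.* k)) (2 ℕ.* k C k)

    -- The right side is the factor of the harmonic number in `term (suc k)`. Multiplied by k + 1,
    -- the same identity carries the induction for `γ-fraction`.
    oddRecip*γ : γ k ≡ + (2 ℕ.^ k) / (2 ℕ.* k C k) →
      oddRecip k * γ k ≡ + (2 ℕ.^ suc k) / (suc k ℕ.* (2 ℕ.* suc k C suc k))
    oddRecip*γ γ≡ = trans (cong (oddRecip k *_) γ≡)
        (trans (/-* 1 (suc (2 ℕ.* k)) (2 ℕ.^ k) (2 ℕ.* k C k))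
          (/-cross (1 ℕ.* 2 ℕ.^ k) _ (2 ℕ.^ suc k) _
            (trans (cong ((1 ℕ.* 2 ℕ.^ k) ℕ.*_) (centralBinomial-suc k)) (eq (2 ℕ.^ k) (suc (2 ℕ.* k) ℕ.* (2 ℕ.* k C k))))))
      where
      eq : ∀ p c → 1 ℕ.* p ℕ.* (2 ℕ.* c) ≡ 2 ℕ.* p ℕ.* c
      eq = ℕ-solver.solve-∀

    γ-suc-fraction : γ k ≡ + (2 ℕ.^ k) / (2 ℕ.* k C k) →
      γ (suc k) ≡ + (2 ℕ.^ suc k) / (2 ℕ.* suc k C suc k)
    γ-suc-fraction γ≡ = begin
      γ (suc k)                              ≡⟨ γ-suc k ⟩
      (1ℚ + ι k) * oddRecip k * γ k          ≡⟨ ℚ.*-assoc (1ℚ + ι k) (oddRecip k) (γ k) ⟩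
      (1ℚ + ι k) * (oddRecip k * γ k)        ≡⟨ cong₂ _*_ (sym (ι-suc k)) (oddRecip*γ γ≡) ⟩
      ι (suc k) * (+ (2 ℕ.^ suc k) / (suc k ℕ.* (2 ℕ.* suc k C suc k)))
        ≡⟨ /-* (suc k) 1 (2 ℕ.^ suc k) (suc k ℕ.* (2 ℕ.* suc k C suc k)) {{_}} {{kC⁺≢0}} {{1kC⁺≢0}} ⟩
      (+ (suc k ℕ.* 2 ℕ.^ suc k) / (1 ℕ.* (suc k ℕ.* (2 ℕ.* suc k C suc k)))) {{1kC⁺≢0}}
        ≡⟨ /-cross (suc k ℕ.* 2 ℕ.^ suc k) _ (2 ℕ.^ suc k) (2 ℕ.* suc k C suc k) {{1kC⁺≢0}}
             (eq (suc k) (2 ℕ.^ suc k) (2 ℕ.* suc k C suc k)) ⟩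
      + (2 ℕ.^ suc k) / (2 ℕ.* suc k C suc k) ∎
      where
      open ≡-Reasoning
      1kC⁺≢0 : NonZero (1 ℕ.* (suc k ℕ.* (2 ℕ.* suc k C suc k)))
      1kC⁺≢0 = ℕ.m*n≢0 1 (suc k ℕ.* (2 ℕ.* suc k C suc k))
      eq : ∀ k p c → k ℕ.* p ℕ.* c ≡ p ℕ.* (1 ℕ.* (k ℕ.* c))
      eq = ℕ-solver.solve-∀

  γ-fraction : ∀ k → γ k ≡ (+ (2 ℕ.^ k) / (2 ℕ.* k C k)) {{centralBinomial≢0 k}}
  γ-fraction zero    = refl
  γ-fraction (suc k) = γ-suc-fraction k (γ-fraction k)

  w-1 : ∀ k → w k 1ℚ ≡ ½ * γ k
  w-1 k = cong₂ (λ s y → s * power k y) sincos-1 sin²-1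

  ∑term≡θ₃ : ∀ K → ∑₁ term K ≡ θ₃ K 1ℚ
  ∑term≡θ₃ zero    = refl
  ∑term≡θ₃ (suc K) = cong₂ _+_ (∑term≡θ₃ K) (begin
    term (suc K)                              ≡⟨ cong (_* H⁽²⁾ K) (sym (oddRecip*γ K (γ-fraction K))) ⟩
    oddRecip K * γ K * H⁽²⁾ K                 ≡⟨ eq (oddRecip K) (γ K) (H⁽²⁾ K) ⟩
    H⁽²⁾ K * (2ℚ * oddRecip K * (½ * γ K))    ≡⟨ cong (λ z → H⁽²⁾ K * (2ℚ * oddRecip K * z)) (sym (w-1 K)) ⟩
    H⁽²⁾ K * (2ℚ * oddRecip K * w K 1ℚ)       ∎)
    where
    open ≡-Reasoning
    eq : ∀ o g H → o * g * H ≡ H * (2ℚ * o * (½ * g))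
    eq = solve-∀ ℚ-ring

  -- Lattice squares in the disc

  innerRow-≥ : ∀ n i b → suc i ℕ.* suc i ℕ.+ b ℕ.* b ℕ.≤ n ℕ.* n → b ℕ.≤ innerRow n i
  innerRow-≥ n i b inside = begin
    b                                        ≡⟨ ℕ.*-identityʳ b ⟨
    -- `[ 0 ≤? 0 ]` evaluates to 1, so `ind-mono` here says that the square is counted.
    b ℕ.* 1                                  ≤⟨ ∑-≥const b 1 row (λ j j<b → ind-mono 0 0 (far i j) (n ℕ.* n)
                                                  λ _ → ℕ.≤-trans (sumsq-mono (ℕ.≤-refl {suc i}) j<b) inside) ⟩
    ∑ b row                                  ≤⟨ ℕ.m≤m+n (∑ b row) _ ⟩
    ∑ b row ℕ.+ ∑ (n ℕ.∸ b) (λ j → row (b ℕ.+ j)) ≡⟨ ∑-+ b (n ℕ.∸ b) row ⟨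
    ∑ (b ℕ.+ (n ℕ.∸ b)) row                  ≡⟨ cong (λ k → ∑ k row) (ℕ.m+[n∸m]≡n b≤n) ⟩
    innerRow n i                             ∎
    where
    open ℕ.≤-Reasoning
    row : ℕ → ℕ
    row j = [ far i j ≤? n ℕ.* n ]
    b≤n : b ℕ.≤ n
    b≤n = ℕ.≮⇒≥ λ n<b → ℕ.<⇒≱ (ℕ.*-mono-< n<b n<b) (ℕ.≤-trans (ℕ.m≤n+m (b ℕ.* b) _) inside)

  innerRow-≤ : ∀ n i b → n ℕ.* n ℕ.≤ i ℕ.* i ℕ.+ b ℕ.* b → innerRow n i ℕ.≤ b
  innerRow-≤ n i b outside with ℕ.≤-total n b
  ... | inj₁ n≤b = ℕ.≤-trans (∑≤n n (λ j → ind≤1 (far i j) (n ℕ.* n))) n≤b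
  ... | inj₂ b≤n = begin
    innerRow n i                             ≡⟨ cong (λ k → ∑ k row) (ℕ.m+[n∸m]≡n b≤n) ⟨
    ∑ (b ℕ.+ (n ℕ.∸ b)) row                  ≡⟨ ∑-+ b (n ℕ.∸ b) row ⟩
    ∑ b row ℕ.+ ∑ (n ℕ.∸ b) (λ j → row (b ℕ.+ j))
      ≤⟨ ℕ.+-mono-≤ (∑≤n b (λ j → ind≤1 (far i j) (n ℕ.* n)))
           -- `[ 1 ≤? 0 ]` evaluates to 0: no square from height `b` upwards is counted.
           (∑-≤const (n ℕ.∸ b) 0 _ (λ j → ind-mono (far i (b ℕ.+ j)) (n ℕ.* n) 1 0 (λ le → contradiction le (beyond j)))) ⟩
    b ℕ.+ (n ℕ.∸ b) ℕ.* 0                    ≡⟨ cong (b ℕ.+_) (ℕ.*-zeroʳ (n ℕ.∸ b)) ⟩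
    b ℕ.+ 0                                  ≡⟨ ℕ.+-identityʳ b ⟩
    b                                        ∎
    where
    open ℕ.≤-Reasoning
    row : ℕ → ℕ
    row j = [ far i j ≤? n ℕ.* n ]
    beyond : ∀ j → far i (b ℕ.+ j) ℕ.≰ n ℕ.* n
    beyond j = ℕ.<⇒≱ (ℕ.≤-<-trans outside (ℕ.+-mono-<-≤ (ℕ.*-mono-< (ℕ.n<1+n i) (ℕ.n<1+n i))
      (ℕ.*-mono-≤ b≤ b≤)))
      where
      b≤ : b ℕ.≤ suc (b ℕ.+ j)
      b≤ = ℕ.m≤n⇒m≤1+n (ℕ.m≤m+n b j)

  module _ (n : ℕ) {a a′ : ℕ} (a′≤a : a′ ℕ.≤ a) where

    private
      split : ∑ a (innerRow n) ≡ ∑ a′ (innerRow n) ℕ.+ ∑ (a ℕ.∸ a′) (λ r → innerRow n (a′ ℕ.+ r))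
      split = trans (cong (λ k → ∑ k (innerRow n)) (sym (ℕ.m+[n∸m]≡n a′≤a))) (∑-+ a′ (a ℕ.∸ a′) (innerRow n))

    -- Between a′ and a the arc is lowest at the right end, so the rectangle of height b lies in the
    -- disc once its corner (a, b) does.
    columns-≥ : ∀ b → a ℕ.* a ℕ.+ b ℕ.* b ℕ.≤ n ℕ.* n →
      ∑ a′ (innerRow n) ℕ.+ (a ℕ.∸ a′) ℕ.* b ℕ.≤ ∑ a (innerRow n)
    columns-≥ b inside = subst (∑ a′ (innerRow n) ℕ.+ (a ℕ.∸ a′) ℕ.* b ℕ.≤_) (sym split) (ℕ.+-monoʳ-≤ (∑ a′ (innerRow n))
      (∑-≥const (a ℕ.∸ a′) b _ λ r r< → innerRow-≥ n (a′ ℕ.+ r) b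
        (ℕ.≤-trans (ℕ.+-monoˡ-≤ (b ℕ.* b) (ℕ.*-mono-≤ (column r r<) (column r r<))) inside)))
      where
      column : ∀ r → r ℕ.< a ℕ.∸ a′ → suc (a′ ℕ.+ r) ℕ.≤ a
      column r r< = subst₂ ℕ._≤_ (ℕ.+-suc a′ r) (ℕ.m+[n∸m]≡n a′≤a) (ℕ.+-monoʳ-≤ a′ r<)

    -- The arc is highest at the left end, so a point (a′, b) on or outside the circle caps every
    -- column to its right.
    columns-≤ : ∀ b → n ℕ.* n ℕ.≤ a′ ℕ.* a′ ℕ.+ b ℕ.* b →
      ∑ a (innerRow n) ℕ.≤ ∑ a′ (innerRow n) ℕ.+ (a ℕ.∸ a′) ℕ.* b
    columns-≤ b outside = subst (ℕ._≤ ∑ a′ (innerRow n) ℕ.+ (a ℕ.∸ a′) ℕ.* b) (sym split) (ℕ.+-monoʳ-≤ (∑ a′ (innerRow n))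
      (∑-≤const (a ℕ.∸ a′) b _ λ r → innerRow-≤ n (a′ ℕ.+ r) b
        (ℕ.≤-trans outside (ℕ.+-monoˡ-≤ (b ℕ.* b) (ℕ.*-mono-≤ (ℕ.m≤m+n a′ r) (ℕ.m≤m+n a′ r))))))

  -- For large K, the area of the quarter disc over [0, cos 2θ] approaches π/4 - W.
  W : ℕ → ℚ → ℚ
  W K t = ½ * θ₁ K t - sincos t * (2ℚ * cos² t - 1ℚ)

  8ℚ : ℚ
  8ℚ = + 8 / 1

  W-diff : ∀ K → Diff (W K) (λ t → 8ℚ * (sincos t * sincos t) * cos² t - cos² t * v K t)
  W-diff K = diff-cong (λ _ → refl)
      (λ t → trans (eq₁ (cos² t) (sincos t) (v K t))
        (trans (cong (λ z → 4ℚ * cos² t * z + 4ℚ * cos² t * (sincos t * sincos t) - cos² t * v K t) (sym (sincos² t)))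
          (eq₂ (cos² t) (sincos t * sincos t) (v K t))))
      (diff-- (diff-scale ½ (θ₁-diff K)) (diff-* sincos-diff (diff-- (diff-scale 2ℚ cos²-diff) (diff-const 1ℚ))))
    where
    eq₁ : ∀ c s v →
      ½ * (2ℚ * c * (1ℚ - v)) - (c * (1ℚ - 2ℚ * (1ℚ - c)) * (2ℚ * c - 1ℚ) + s * (2ℚ * - (2ℚ * s * c) - 0ℚ))
      ≡ 4ℚ * c * (c * (1ℚ - c)) + 4ℚ * c * (s * s) - c * v
    eq₁ = solve-∀ ℚ-ring
    eq₂ : ∀ c s² v → 4ℚ * c * s² + 4ℚ * c * s² - c * v ≡ 8ℚ * s² * c - c * v
    eq₂ = solve-∀ ℚ-ring

  W-0 : ∀ K → W K 0ℚ ≡ 0ℚ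
  W-0 K = trans (cong₂ (λ x y → ½ * x - y * (2ℚ * cos² 0ℚ - 1ℚ)) (θ₁-0 K) (ℚ.*-zeroˡ (cos² 0ℚ))) (eq (2ℚ * cos² 0ℚ - 1ℚ))
    where
    eq : ∀ x → ½ * 0ℚ - 0ℚ * x ≡ 0ℚ
    eq = solve-∀ ℚ-ring

  W-1 : ∀ K → W K 1ℚ ≡ ½ * θ₁ K 1ℚ
  W-1 K = trans (cong (λ c → ½ * θ₁ K 1ℚ - sincos 1ℚ * (2ℚ * c - 1ℚ)) cos²-1) (eq (½ * θ₁ K 1ℚ) (sincos 1ℚ))
    where
    cos²-1 : cos² 1ℚ ≡ ½
    cos²-1 = trans (sym (ℚ.*-identityˡ (cos² 1ℚ))) sincos-1
    eq : ∀ x s → x - s * (2ℚ * ½ - 1ℚ) ≡ x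
    eq = solve-∀ ℚ-ring

  -- Lattice points on a circle and the columns between them

  module Circle (m n′ : ℕ)
    (divisible : ∀ i → i ℕ.≤ suc m → suc m ℕ.* suc m ℕ.+ i ℕ.* i ∣ suc n′) where

    M n : ℕ
    M = suc m
    n = suc n′

    norm : ℕ → ℕ
    norm i = M ℕ.* M ℕ.+ i ℕ.* i

    -- For tan θ = i/M, the point (a i, b i) is n (cos 2θ, sin 2θ).
    q a b P : ℕ → ℕ
    q i = n ℕ./ norm i
    a i = q i ℕ.* (M ℕ.* M ℕ.∸ i ℕ.* i)
    b i = q i ℕ.* (2 ℕ.* (M ℕ.* i))
    P i = ∑ (a i) (innerRow n)

    q*norm : ∀ i → i ℕ.≤ M → q i ℕ.* norm i ≡ n
    q*norm i i≤M = m/n*n≡m (divisible i i≤M)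

    q-anti : ∀ i → suc i ℕ.≤ M → q (suc i) ℕ.≤ q i
    q-anti i i<M = ℕ.*-cancelʳ-≤ (q (suc i)) (q i) (norm i) (begin
      q (suc i) ℕ.* norm i         ≤⟨ ℕ.*-monoʳ-≤ (q (suc i)) (ℕ.+-monoʳ-≤ (M ℕ.* M) (ℕ.*-mono-≤ (ℕ.n≤1+n i) (ℕ.n≤1+n i))) ⟩
      q (suc i) ℕ.* norm (suc i)   ≡⟨ q*norm (suc i) i<M ⟩
      n                            ≡⟨ q*norm i (ℕ.<⇒≤ i<M) ⟨
      q i ℕ.* norm i               ∎)
      where open ℕ.≤-Reasoning

    a-anti : ∀ i → suc i ℕ.≤ M → a (suc i) ℕ.≤ a i
    a-anti i i<M = ℕ.*-mono-≤ (q-anti i i<M) (ℕ.∸-monoʳ-≤ (M ℕ.* M) (ℕ.*-mono-≤ (ℕ.n≤1+n i) (ℕ.n≤1+n i)))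

    -- The Pythagorean identity (M² - i²)² + (2Mi)² = (M² + i²)². Writing M² = d + i² turns the
    -- truncated difference into a variable.
    on-circle : ∀ i → i ℕ.≤ M → a i ℕ.* a i ℕ.+ b i ℕ.* b i ≡ n ℕ.* n
    on-circle i i≤M = begin
      a i ℕ.* a i ℕ.+ b i ℕ.* b i                                 ≡⟨ eq₁ (q i) d M i ⟩
      q i ℕ.* q i ℕ.* (d ℕ.* d ℕ.+ 4 ℕ.* (M ℕ.* M) ℕ.* (i ℕ.* i)) ≡⟨ cong (λ s → q i ℕ.* q i ℕ.* (d ℕ.* d ℕ.+ 4 ℕ.* s ℕ.* (i ℕ.* i))) d+i² ⟨
      q i ℕ.* q i ℕ.* (d ℕ.* d ℕ.+ 4 ℕ.* (d ℕ.+ i ℕ.* i) ℕ.* (i ℕ.* i)) ≡⟨ eq₂ (q i) d i ⟩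
      q i ℕ.* (d ℕ.+ i ℕ.* i ℕ.+ i ℕ.* i) ℕ.* (q i ℕ.* (d ℕ.+ i ℕ.* i ℕ.+ i ℕ.* i))
        ≡⟨ cong (λ s → q i ℕ.* (s ℕ.+ i ℕ.* i) ℕ.* (q i ℕ.* (s ℕ.+ i ℕ.* i))) d+i² ⟩
      q i ℕ.* norm i ℕ.* (q i ℕ.* norm i)                         ≡⟨ cong₂ ℕ._*_ (q*norm i i≤M) (q*norm i i≤M) ⟩
      n ℕ.* n                                                     ∎
      where
      open ≡-Reasoning
      d : ℕ
      d = M ℕ.* M ℕ.∸ i ℕ.* i
      d+i² : d ℕ.+ i ℕ.* i ≡ M ℕ.* M
      d+i² = ℕ.m∸n+n≡m (ℕ.*-mono-≤ i≤M i≤M)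
      eq₁ : ∀ q d M i → q ℕ.* d ℕ.* (q ℕ.* d) ℕ.+ q ℕ.* (2 ℕ.* (M ℕ.* i)) ℕ.* (q ℕ.* (2 ℕ.* (M ℕ.* i)))
        ≡ q ℕ.* q ℕ.* (d ℕ.* d ℕ.+ 4 ℕ.* (M ℕ.* M) ℕ.* (i ℕ.* i))
      eq₁ = ℕ-solver.solve-∀
      eq₂ : ∀ q d i → q ℕ.* q ℕ.* (d ℕ.* d ℕ.+ 4 ℕ.* (d ℕ.+ i ℕ.* i) ℕ.* (i ℕ.* i))
        ≡ q ℕ.* (d ℕ.+ i ℕ.* i ℕ.+ i ℕ.* i) ℕ.* (q ℕ.* (d ℕ.+ i ℕ.* i ℕ.+ i ℕ.* i))
      eq₂ = ℕ-solver.solve-∀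

    z r : ℚ
    z = recip n′
    r = recip m

    n*z : ι n * z ≡ 1ℚ
    n*z = trans (cong (_* z) (ι-suc n′)) (ι-recip n′)

    M*r : ι M * r ≡ 1ℚ
    M*r = trans (cong (_* r) (ι-suc m)) (ι-recip m)

    q*norm*z : ∀ i → i ℕ.≤ M → ι (q i) * (ι M * ι M + ι i * ι i) * z ≡ 1ℚ
    q*norm*z i i≤M = trans (cong (_* z) (trans (cong (ι (q i) *_) (sym norm≡)) (trans (sym (ι-* (q i) (norm i))) (cong ι (q*norm i i≤M))))) n*z
      where
      norm≡ : ι (norm i) ≡ ι M * ι M + ι i * ι i
      norm≡ = trans (ι-+ (M ℕ.* M) (i ℕ.* i)) (cong₂ _+_ (ι-* M M) (ι-* i i))

    cos²-grid : ∀ i → i ℕ.≤ M → cos² (grid m i) ≡ ι (q i) * (ι M * ι M) * z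
    cos²-grid i i≤M = begin
      c                                                         ≡⟨ ℚ.*-identityˡ c ⟨
      1ℚ * c                                                    ≡⟨ cong (_* c) (q*norm*z i i≤M) ⟨
      ι (q i) * (ι M * ι M + ι i * ι i) * z * c                 ≡⟨ cong (λ j → ι (q i) * (ι M * ι M + j * j) * z * c) i≡ ⟩
      ι (q i) * (ι M * ι M + ι M * t * (ι M * t)) * z * c       ≡⟨ eq (ι (q i)) (ι M) t z c ⟩
      ι (q i) * (ι M * ι M) * z * ((1ℚ + t * t) * c)            ≡⟨ cong (ι (q i) * (ι M * ι M) * z *_) (cos²-inverse t) ⟩
      ι (q i) * (ι M * ι M) * z * 1ℚ                            ≡⟨ ℚ.*-identityʳ _ ⟩
      ι (q i) * (ι M * ι M) * z                                 ∎
      where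
      open ≡-Reasoning
      t c : ℚ
      t = grid m i
      c = cos² t
      eq : ∀ q M t z c → q * (M * M + M * t * (M * t)) * z * c ≡ q * (M * M) * z * ((1ℚ + t * t) * c)
      eq = solve-∀ ℚ-ring
      eq′ : ∀ M i r → M * (i * r) ≡ i * (M * r)
      eq′ = solve-∀ ℚ-ring
      i≡ : ι i ≡ ι M * t
      i≡ = sym (trans (eq′ (ι M) (ι i) r) (trans (cong (ι i *_) M*r) (ℚ.*-identityʳ (ι i))))

    a*z : ∀ i → i ℕ.≤ M → ι (a i) * z ≡ 2ℚ * cos² (grid m i) - 1ℚ
    a*z i i≤M = begin
      ι (a i) * z                                       ≡⟨ cong (_* z) (ι-* (q i) _) ⟩
      ι (q i) * ι d * z                                 ≡⟨ cong (λ x → ι (q i) * x * z) d≡ ⟩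
      ι (q i) * (ι M * ι M - ι i * ι i) * z             ≡⟨ eq (ι (q i)) (ι M) (ι i) z ⟩
      2ℚ * (ι (q i) * (ι M * ι M) * z) - ι (q i) * (ι M * ι M + ι i * ι i) * z
        ≡⟨ cong₂ (λ x y → 2ℚ * x - y) (sym (cos²-grid i i≤M)) (q*norm*z i i≤M) ⟩
      2ℚ * cos² (grid m i) - 1ℚ                         ∎
      where
      open ≡-Reasoning
      d : ℕ
      d = M ℕ.* M ℕ.∸ i ℕ.* i
      eq : ∀ q M i z → q * (M * M - i * i) * z ≡ 2ℚ * (q * (M * M) * z) - q * (M * M + i * i) * z
      eq = solve-∀ ℚ-ring
      cancel : ∀ x y → x ≡ x + y - y
      cancel = solve-∀ ℚ-ring
      d≡ : ι d ≡ ι M * ι M - ι i * ι i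
      d≡ = trans (cancel (ι d) (ι i * ι i)) (cong (_- ι i * ι i)
        (trans (cong (λ x → ι d + x) (sym (ι-* i i))) (trans (sym (ι-+ d (i ℕ.* i)))
          (trans (cong ι (ℕ.m∸n+n≡m (ℕ.*-mono-≤ i≤M i≤M))) (ι-* M M)))))

    b*z : ∀ i → i ℕ.≤ M → ι (b i) * z ≡ 2ℚ * sincos (grid m i)
    b*z i i≤M = begin
      ι (b i) * z                                       ≡⟨ cong (_* z) (trans (ι-* (q i) _) (cong (ι (q i) *_) (trans (ι-* 2 (M ℕ.* i)) (cong (2ℚ *_) (ι-* M i))))) ⟩
      ι (q i) * (2ℚ * (ι M * ι i)) * z                  ≡⟨ ℚ.*-identityˡ _ ⟨
      1ℚ * (ι (q i) * (2ℚ * (ι M * ι i)) * z)           ≡⟨ cong (_* (ι (q i) * (2ℚ * (ι M * ι i)) * z)) M*r ⟨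
      ι M * r * (ι (q i) * (2ℚ * (ι M * ι i)) * z)      ≡⟨ eq (ι (q i)) (ι M) (ι i) r z ⟩
      2ℚ * (ι i * r * (ι (q i) * (ι M * ι M) * z))      ≡⟨ cong (λ c → 2ℚ * (grid m i * c)) (cos²-grid i i≤M) ⟨
      2ℚ * sincos (grid m i)                            ∎
      where
      open ≡-Reasoning
      eq : ∀ q M i r z → M * r * (q * (2ℚ * (M * i)) * z) ≡ 2ℚ * (i * r * (q * (M * M) * z))
      eq = solve-∀ ℚ-ring

    -- The inner squares over [0, cos 2θ], rescaled to radius 1.
    area : ℕ → ℚ
    area i = ι (P i) * z * z

    z²-mono : ∀ {x y} → x ≤ y → x * z * z ≤ y * z * z
    z²-mono {x} {y} x≤y = ℚ.*-monoʳ-≤-nonNeg z {{nonNegative (0≤recip n′)}}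
      (ℚ.*-monoʳ-≤-nonNeg z {{nonNegative (0≤recip n′)}} x≤y)

    -- A rectangle of width cos 2θᵢ - cos 2θᵢ₊₁ and height sin 2θⱼ is added. With j = i it is
    -- inscribed under the arc, with j = i + 1 circumscribed.
    strip : ∀ i j → i ℕ.< M → j ℕ.≤ M → ι (P (suc i) ℕ.+ (a i ℕ.∸ a (suc i)) ℕ.* b j) * z * z
      ≡ area (suc i) + 4ℚ * sincos (grid m j) * (cos² (grid m i) - cos² (grid m (suc i)))
    strip i j i<M j≤M = begin
      ι (P (suc i) ℕ.+ δ ℕ.* b j) * z * z
        ≡⟨ cong (λ x → x * z * z) (trans (ι-+ (P (suc i)) _) (cong (λ x → ι (P (suc i)) + x) (ι-* δ (b j)))) ⟩
      (ι (P (suc i)) + ι δ * ι (b j)) * z * z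
        ≡⟨ cong (λ x → (ι (P (suc i)) + x * ι (b j)) * z * z) δ≡ ⟩
      (ι (P (suc i)) + (ι (a i) - ι (a (suc i))) * ι (b j)) * z * z
        ≡⟨ eq₁ (ι (P (suc i))) (ι (a i)) (ι (a (suc i))) (ι (b j)) z ⟩
      area (suc i) + ι (b j) * z * (ι (a i) * z - ι (a (suc i)) * z)
        ≡⟨ cong₂ (λ x y → area (suc i) + x * y) (b*z j j≤M) (cong₂ _-_ (a*z i (ℕ.<⇒≤ i<M)) (a*z (suc i) i<M)) ⟩
      area (suc i) + 2ℚ * sincos (grid m j) * (2ℚ * cos² (grid m i) - 1ℚ - (2ℚ * cos² (grid m (suc i)) - 1ℚ))
        ≡⟨ eq₂ (area (suc i)) (sincos (grid m j)) (cos² (grid m i)) (cos² (grid m (suc i))) ⟩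
      area (suc i) + 4ℚ * sincos (grid m j) * (cos² (grid m i) - cos² (grid m (suc i))) ∎
      where
      open ≡-Reasoning
      δ : ℕ
      δ = a i ℕ.∸ a (suc i)
      cancel : ∀ x y → x ≡ x + y - y
      cancel = solve-∀ ℚ-ring
      δ≡ : ι δ ≡ ι (a i) - ι (a (suc i))
      δ≡ = trans (cancel (ι δ) (ι (a (suc i)))) (cong (_- ι (a (suc i)))
        (trans (sym (ι-+ δ (a (suc i)))) (cong ι (ℕ.m∸n+n≡m (a-anti i i<M)))))
      eq₁ : ∀ p a a′ b z → (p + (a - a′) * b) * z * z ≡ p * z * z + b * z * (a * z - a′ * z)
      eq₁ = solve-∀ ℚ-ring
      eq₂ : ∀ p s c c′ → p + 2ℚ * s * (2ℚ * c - 1ℚ - (2ℚ * c′ - 1ℚ)) ≡ p + 4ℚ * s * (c - c′)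
      eq₂ = solve-∀ ℚ-ring

    area-≥ : ∀ i → i ℕ.< M →
      area (suc i) + 4ℚ * sincos (grid m i) * (cos² (grid m i) - cos² (grid m (suc i))) ≤ area i
    area-≥ i i<M = subst (_≤ area i) (strip i i i<M (ℕ.<⇒≤ i<M))
      (z²-mono (ι-mono (columns-≥ n (a-anti i i<M) (b i) (ℕ.≤-reflexive (on-circle i (ℕ.<⇒≤ i<M))))))

    area-≤ : ∀ i → i ℕ.< M →
      area i ≤ area (suc i) + 4ℚ * sincos (grid m (suc i)) * (cos² (grid m i) - cos² (grid m (suc i)))
    area-≤ i i<M = subst (area i ≤_) (strip i (suc i) i<M i<M)
      (z²-mono (ι-mono (columns-≤ n (a-anti i i<M) (b (suc i)) (ℕ.≤-reflexive (sym (on-circle (suc i) i<M))))))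

    area-0 : innerArea n ≡ 4ℚ * area 0
    area-0 = begin
      innerArea n                                       ≡⟨ /-ι-recip (4 ℕ.* innerSquares n) (n′ ℕ.+ n′ ℕ.* n) ⟩
      ι (4 ℕ.* innerSquares n) * recip (n′ ℕ.+ n′ ℕ.* n) ≡⟨ cong₂ _*_ (ι-* 4 (innerSquares n)) (sym (/-* 1 n 1 n)) ⟩
      4ℚ * ι (innerSquares n) * (z * z)                 ≡⟨ eq (ι (innerSquares n)) z ⟩
      4ℚ * (ι (innerSquares n) * z * z)                 ≡⟨ cong (λ k → 4ℚ * (ι (∑ k (innerRow n)) * z * z)) a-0 ⟨
      4ℚ * area 0                                       ∎
      where
      open ≡-Reasoning
      eq : ∀ s z → 4ℚ * s * (z * z) ≡ 4ℚ * (s * z * z)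
      eq = solve-∀ ℚ-ring
      a-0 : a 0 ≡ n
      a-0 = trans (cong (q 0 ℕ.*_) (sym (ℕ.+-identityʳ (M ℕ.* M)))) (q*norm 0 z≤n)

    area-M : area M ≡ 0ℚ
    area-M = trans (cong (λ k → ι (∑ k (innerRow n)) * z * z) (trans (cong (q M ℕ.*_) (ℕ.n∸n≡0 (M ℕ.* M))) (ℕ.*-zeroʳ (q M))))
      (eq z)
      where
      eq : ∀ z → 0ℚ * z * z ≡ 0ℚ
      eq = solve-∀ ℚ-ring

  -- The area of the disc compared with θ₁ at t = 1

  module _ (K : ℕ) where

    private
      -- Coefficients of h²: `φ` collects the remainders of `W K` and of the inscribed rectangle,
      -- and `κ` is the circumscribed minus the inscribed rectangle, a product of two increments of
      -- order h.
      φ κ : ℚ → ℚ → ℚ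
      φ t h = W-diff K .rem t h + 4ℚ * sincos t * cos²-diff .rem t h
      κ t h = 4ℚ * ((cos² t * (1ℚ - 2ℚ * sin² t) + h * sincos-diff .rem t h)
        * (- 1ℚ * (- (2ℚ * sincos t * cos² t) + h * cos²-diff .rem t h)))

      φ-bounded : Bounded φ
      φ-bounded = bounded-+ (W-diff K .boundedRem)
        (bounded-* (bounded-* (bounded-const 4ℚ) (sincos-diff .bounded)) (cos²-diff .boundedRem))

      κ-bounded : Bounded κ
      κ-bounded = bounded-* (bounded-const 4ℚ) (bounded-*
        (bounded-+ (sincos-diff .bounded′) (bounded-* bounded-h (sincos-diff .boundedRem)))
        (bounded-* (bounded-const (- 1ℚ)) (bounded-+ (cos²-diff .bounded′) (bounded-* bounded-h (cos²-diff .boundedRem)))))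

    -- Depends on `K` but neither on the grid nor on the radius, so the grid can be refined with `K`
    -- fixed.
    discretisation : ℚ
    discretisation = proj₁ φ-bounded + proj₁ κ-bounded

    module _ (m n′ : ℕ) (divisible : ∀ i → i ℕ.≤ suc m → suc m ℕ.* suc m ℕ.+ i ℕ.* i ∣ suc n′) where

      open Circle m n′ divisible

      -- To first order the area loses 8 h (sin θ cos θ)² cos² θ and `W K` gains the same, less h
      -- cos² θ · `v K t`. The gap to the inscribed rectangle is at most that between the two
      -- rectangles.
      area+W-step : ∀ i → i ℕ.< M →
        ∣ (area (suc i) + W K (grid m (suc i))) - (area i + W K (grid m i)) ∣
          ≤ recip m * (1ℚ * γ K) + recip m * recip m * discretisation
      area+W-step i i<M = subst₂ (λ x y → ∣ x ∣ ≤ y) (sym step≡)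
          (collect h (1ℚ * γ K) (proj₁ φ-bounded) (proj₁ κ-bounded))
          (∣p-q∣≤ (∣p+q∣≤
              (∣p*q∣≤ ∣h∣≤ (subst (_≤ 1ℚ * γ K) (sym (ℚ.∣-p∣≡∣p∣ (c * v K t)))
                (∣p*q∣≤ {c} (∣cos²∣≤1 t) (∣v∣≤γ K t t∈))))
              (∣p*q∣≤ (∣p*q∣≤ ∣h∣≤ ∣h∣≤) (proj₂ φ-bounded t h t∈ h∈)))
            (∣p∣≤-nonneg (0≤q-p lower) gap≤))
        where
        t h c s c⁺ s⁺ g g⁺ gap : ℚ
        t = grid m i
        h = recip m
        c = cos² t
        s = sincos t
        c⁺ = cos² (t + h)
        s⁺ = sincos (t + h)
        g = area i
        g⁺ = area (suc i)
        gap = g - (g⁺ + 4ℚ * s * (c - c⁺))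
        t∈ : Unit t
        t∈ = grid∈ m (ℕ.<⇒≤ i<M)
        h∈ : Unit h
        h∈ = recip∈ m
        ∣h∣≤ : ∣ h ∣ ≤ h
        ∣h∣≤ = ∣p∣≤-nonneg (0≤recip m) ℚ.≤-refl
        lower : g⁺ + 4ℚ * s * (c - c⁺) ≤ g
        lower = subst (λ t⁺ → g⁺ + 4ℚ * s * (c - cos² t⁺) ≤ g) (grid-suc m i) (area-≥ i i<M)
        upper : g ≤ g⁺ + 4ℚ * s⁺ * (c - c⁺)
        upper = subst (λ t⁺ → g ≤ g⁺ + 4ℚ * sincos t⁺ * (c - cos² t⁺)) (grid-suc m i) (area-≤ i i<M)
        collect : ∀ h γ B₁ B₂ → h * γ + h * h * B₁ + h * h * B₂ ≡ h * γ + h * h * (B₁ + B₂)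
        collect = solve-∀ ℚ-ring
        eq₁ : ∀ g g⁺ W c s v rW rc h →
          (g⁺ + (W + h * (8ℚ * (s * s) * c - c * v) + h * h * rW)) - (g + W)
          ≡ h * - (c * v) + h * h * (rW + 4ℚ * s * rc)
            - (g - (g⁺ + 4ℚ * s * (c - (c + h * - (2ℚ * s * c) + h * h * rc))))
        eq₁ = solve-∀ ℚ-ring
        eq₂ : ∀ g⁺ s s′ rs c c′ rc h →
          (g⁺ + 4ℚ * (s + h * s′ + h * h * rs) * (c - (c + h * c′ + h * h * rc)))
            - (g⁺ + 4ℚ * s * (c - (c + h * c′ + h * h * rc)))
          ≡ h * h * (4ℚ * ((s′ + h * rs) * (- 1ℚ * (c′ + h * rc))))
        eq₂ = solve-∀ ℚ-ring
        step≡ : (g⁺ + W K (grid m (suc i))) - (g + W K t) ≡ h * - (c * v K t) + h * h * φ t h - gap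
        step≡ = begin
          (g⁺ + W K (grid m (suc i))) - (g + W K t)
            ≡⟨ cong (λ x → (g⁺ + W K x) - (g + W K t)) (grid-suc m i) ⟩
          (g⁺ + W K (t + h)) - (g + W K t)
            ≡⟨ cong (λ x → (g⁺ + x) - (g + W K t)) (W-diff K .expand t h) ⟩
          (g⁺ + (W K t + h * (8ℚ * (s * s) * c - c * v K t) + h * h * W-diff K .rem t h)) - (g + W K t)
            ≡⟨ eq₁ g g⁺ (W K t) c s (v K t) (W-diff K .rem t h) (cos²-diff .rem t h) h ⟩
          h * - (c * v K t) + h * h * φ t h
            - (g - (g⁺ + 4ℚ * s * (c - (c + h * - (2ℚ * s * c) + h * h * cos²-diff .rem t h))))
            ≡⟨ cong (λ x → h * - (c * v K t) + h * h * φ t h - (g - (g⁺ + 4ℚ * s * (c - x)))) (cos²-diff .expand t h) ⟨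
          h * - (c * v K t) + h * h * φ t h - gap ∎
          where open ≡-Reasoning
        gap≤ : gap ≤ h * h * proj₁ κ-bounded
        gap≤ = begin
          gap
            ≤⟨ ℚ.+-monoˡ-≤ (- (g⁺ + 4ℚ * s * (c - c⁺))) upper ⟩
          (g⁺ + 4ℚ * s⁺ * (c - c⁺)) - (g⁺ + 4ℚ * s * (c - c⁺))
            ≡⟨ cong₂ (λ x y → (g⁺ + 4ℚ * x * (c - y)) - (g⁺ + 4ℚ * s * (c - y)))
                 (sincos-diff .expand t h) (cos²-diff .expand t h) ⟩
          (g⁺ + 4ℚ * (s + h * (c * (1ℚ - 2ℚ * sin² t)) + h * h * sincos-diff .rem t h)
              * (c - (c + h * - (2ℚ * s * c) + h * h * cos²-diff .rem t h)))
            - (g⁺ + 4ℚ * s * (c - (c + h * - (2ℚ * s * c) + h * h * cos²-diff .rem t h)))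
            ≡⟨ eq₂ g⁺ s (c * (1ℚ - 2ℚ * sin² t)) (sincos-diff .rem t h) c (- (2ℚ * s * c)) (cos²-diff .rem t h) h ⟩
          h * h * κ t h
            ≤⟨ ℚ.*-monoˡ-≤-nonNeg (h * h) {{nonNegative (0≤square h)}}
                 (ℚ.≤-trans (p≤∣p∣ (κ t h)) (proj₂ κ-bounded t h t∈ h∈)) ⟩
          h * h * proj₁ κ-bounded ∎
          where open ℚ.≤-Reasoning

      -- The steps add up to ½ θ₁ at t = 1 minus `area 0`; the factor -4 turns this into the claimed
      -- difference.
      innerArea≈θ₁ : ∣ innerArea (suc n′) - 2ℚ * θ₁ K 1ℚ ∣ ≤ 4ℚ * γ K + 4ℚ * discretisation * recip m
      innerArea≈θ₁ = subst₂ (λ x y → ∣ x ∣ ≤ y) difference (distribute (γ K) discretisation (recip m))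
        (∣p*q∣≤ { - 4ℚ} {(area M + W K (grid m M)) - (area 0 + W K (grid m 0))} {4ℚ} ℚ.≤-refl
          (small-grid-steps (λ i → area i + W K (grid m i)) (1ℚ * γ K) discretisation m area+W-step))
        where
        distribute : ∀ γ B r → 4ℚ * (1ℚ * γ + B * r) ≡ 4ℚ * γ + 4ℚ * B * r
        distribute = solve-∀ ℚ-ring
        eq : ∀ θ g → (- 4ℚ) * ((0ℚ + ½ * θ) - (g + 0ℚ)) ≡ 4ℚ * g - 2ℚ * θ
        eq = solve-∀ ℚ-ring
        difference : (- 4ℚ) * ((area M + W K (grid m M)) - (area 0 + W K (grid m 0))) ≡ innerArea (suc n′) - 2ℚ * θ₁ K 1ℚ
        difference = trans
          (cong₂ (λ x y → (- 4ℚ) * (x - (area 0 + y)))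
            (cong₂ _+_ area-M (trans (cong (W K) (grid-end m)) (W-1 K)))
            (trans (cong (W K) (grid-0 m)) (W-0 K)))
          (trans (eq (θ₁ K 1ℚ) (area 0)) (cong (_- 2ℚ * θ₁ K 1ℚ) (sym area-0)))

  -- All the norms are positive and at most 2M², hence divide (2M²)!. The bound m ≤ n′ makes the
  -- radius grow with the grid, as the comparison with π requires.
  ∃-radius : ∀ m → ∃[ n′ ] m ℕ.≤ n′ × (∀ i → i ℕ.≤ suc m → suc m ℕ.* suc m ℕ.+ i ℕ.* i ∣ suc n′)
  ∃-radius m = ℕ.pred ((2 ℕ.* (M ℕ.* M)) !) , ℕ.s≤s⁻¹ (subst (M ℕ.≤_) (sym suc-n′) M≤)
      , λ i i≤M → subst (M ℕ.* M ℕ.+ i ℕ.* i ∣_) (sym suc-n′) (divides! i i≤M)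
    where
    M : ℕ
    M = suc m
    instance
      _ = (2 ℕ.* (M ℕ.* M)) ℕ.!≢0
    suc-n′ : suc (ℕ.pred ((2 ℕ.* (M ℕ.* M)) !)) ≡ (2 ℕ.* (M ℕ.* M)) !
    suc-n′ = ℕ.suc-pred ((2 ℕ.* (M ℕ.* M)) !)
    divides! : ∀ i → i ℕ.≤ M → M ℕ.* M ℕ.+ i ℕ.* i ∣ (2 ℕ.* (M ℕ.* M)) !
    divides! i i≤M = ∣-trans (m∣m*n (ℕ.pred (M ℕ.* M ℕ.+ i ℕ.* i) !)) (m≤n⇒m!∣n!
      (subst (M ℕ.* M ℕ.+ i ℕ.* i ℕ.≤_) (cong (M ℕ.* M ℕ.+_) (sym (ℕ.+-identityʳ (M ℕ.* M))))
        (ℕ.+-monoʳ-≤ (M ℕ.* M) (ℕ.*-mono-≤ i≤M i≤M))))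
    M≤ : M ℕ.≤ (2 ℕ.* (M ℕ.* M)) !
    M≤ = ℕ.≤-trans (ℕ.≤-trans (ℕ.m≤m*n M M) (ℕ.m≤m+n (M ℕ.* M) 0)) (∣⇒≤ (divides! 0 z≤n))

  -- The circle argument reaches only special radii; `innerArea-close` carries its bound to every
  -- `j`. As the left side is independent of `m`, the discretisation term disappears in the limit.
  π≈θ₁ : ∀ K N j → N ℕ.≤ j → ∣ innerArea (suc j) - 2ℚ * θ₁ K 1ℚ ∣ ≤ 8ℚ * recip N + 4ℚ * γ K
  π≈θ₁ K N j N≤j = ≤-recip-limit (4ℚ * discretisation K) N λ m N≤m → bound m N≤m (∃-radius m)
    where
    p : ℚ
    p = innerArea (suc j)
    bound : ∀ m → N ℕ.≤ m →
      ∃[ n′ ] m ℕ.≤ n′ × (∀ i → i ℕ.≤ suc m → suc m ℕ.* suc m ℕ.+ i ℕ.* i ∣ suc n′) →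
      ∣ p - 2ℚ * θ₁ K 1ℚ ∣ ≤ 8ℚ * recip N + 4ℚ * γ K + 4ℚ * discretisation K * recip m
    bound m N≤m (n′ , m≤n′ , divisible) = subst₂ (λ x y → ∣ x ∣ ≤ y)
      (telescope p (innerArea (suc n′)) (2ℚ * θ₁ K 1ℚ))
      (sym (ℚ.+-assoc (8ℚ * recip N) (4ℚ * γ K) (4ℚ * discretisation K * recip m)))
      (∣p+q∣≤ {p - innerArea (suc n′)}
        (subst (∣ p - innerArea (suc n′) ∣ ≤_) (/-ι-recip 8 N) (innerArea-close N j n′ N≤j (ℕ.≤-trans N≤m m≤n′)))
        (innerArea≈θ₁ K m n′ divisible))
      where
      telescope : ∀ p a θ → (p - a) + (a - θ) ≡ p - θ
      telescope = solve-∀ ℚ-ring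

  -- With d = p - 2A one has p³ - 8A³ = d (12A² + 6Ad + d²). Here |d| ≤ (8 + 4 · 2)/(n + 1), which
  -- is at most 1 from n = 15 on; together with |A| ≤ 2 this bounds the cofactor by 48 + 12 + 1 =
  -- 61.
  ∑term≈π³/48 : ∀ n j → 15 ℕ.≤ n → n ℕ.≤ j →
    ∣ ∑₁ term n - innerArea (suc j) * (innerArea (suc j) * (innerArea (suc j) * 1ℚ)) * (+ 1 / 48) ∣
      ≤ ι 70 * recip n
  ∑term≈π³/48 n j 15≤n n≤j = subst (λ x → ∣ x - p * (p * (p * 1ℚ)) * (+ 1 / 48) ∣ ≤ ι 70 * r) (sym (∑term≡θ₃ n))
      (ℚ.≤-trans
        (subst (λ x → ∣ x ∣ ≤ ι 24 * γ n + (+ 1 / 48) * (ι 16 * r * ι 61)) (sym (eq (θ₃ n 1ℚ) A p))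
          (∣p-q∣≤ {θ₃ n 1ℚ - ⅙ * (A * A * A)} (θ₃≈θ₁³/6 n)
            (∣p*q∣≤ {+ 1 / 48} ℚ.≤-refl (∣p*q∣≤ {d} d≤
              (∣p+q∣≤ {ι 12 * A * A + ι 6 * A * d}
                (∣p+q∣≤ {ι 12 * A * A} (∣p*q∣≤ {ι 12 * A} (∣p*q∣≤ {ι 12} ℚ.≤-refl A≤) A≤)
                  (∣p*q∣≤ {ι 6 * A} (∣p*q∣≤ {ι 6} ℚ.≤-refl A≤) d≤1))
                (∣p*q∣≤ {d} d≤1 d≤1))))))
        total)
    where
    p A d r : ℚ
    p = innerArea (suc j)
    A = θ₁ n 1ℚ
    d = p - 2ℚ * A
    r = recip n
    A≤ : ∣ A ∣ ≤ 2ℚ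
    A≤ = ∣θ₁∣≤2 n 1ℚ 1∈
    d≤ : ∣ d ∣ ≤ ι 16 * r
    d≤ = ℚ.≤-trans (π≈θ₁ n n j n≤j) (subst (8ℚ * r + 4ℚ * γ n ≤_) (sum r)
        (ℚ.+-monoʳ-≤ (8ℚ * r) (ℚ.*-monoˡ-≤-nonNeg 4ℚ (γ≤ n))))
      where
      sum : ∀ r → 8ℚ * r + 4ℚ * (2ℚ * r) ≡ ι 16 * r
      sum = solve-∀ ℚ-ring
    d≤1 : ∣ d ∣ ≤ 1ℚ
    d≤1 = ℚ.≤-trans d≤ (ℚ.*-monoˡ-≤-nonNeg (ι 16) (recip-anti 15≤n))
    eq : ∀ θ A p → θ - p * (p * (p * 1ℚ)) * (+ 1 / 48) ≡ (θ - ⅙ * (A * A * A))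
      - (+ 1 / 48) * ((p - 2ℚ * A) * (ι 12 * A * A + ι 6 * A * (p - 2ℚ * A) + (p - 2ℚ * A) * (p - 2ℚ * A)))
    eq = solve-∀ ℚ-ring
    total : ι 24 * γ n + (+ 1 / 48) * (ι 16 * r * ι 61) ≤ ι 70 * r
    total = ℚ.≤-trans (ℚ.+-monoˡ-≤ ((+ 1 / 48) * (ι 16 * r * ι 61)) (ℚ.*-monoˡ-≤-nonNeg (ι 24) (γ≤ n)))
      -- The errors are 48 r from the cubic relation and 61/3 r from π; 5/3 is what remains up to
      -- 70.
      (≤-by {d = (+ 5 / 3) * r} (*-nonneg (ℚ.nonNegative⁻¹ (+ 5 / 3)) (0≤recip n)) (sum r))
      where
      sum : ∀ r → ι 70 * r ≡ ι 24 * (2ℚ * r) + (+ 1 / 48) * (ι 16 * r * ι 61) + (+ 5 / 3) * r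
      sum = solve-∀ ℚ-ring

open Defs using (_*_; _^_)

theorem1p1 : HasSum₁ term (π ^ 3 * fromℚ (+ 1 / 48))
-- The approximations of π may start at the length `n` of the partial sum, since the estimate is
-- uniform in j ≥ n.
theorem1p1 ε ε>0 = 15 ℕ.⊔ N , λ n n≥ ε′ ε′>0 → n , λ j n≤j →
  ℚ.≤-trans (∑term≈π³/48 n j (ℕ.m⊔n≤o⇒m≤o 15 N n≥) n≤j)
    (ℚ.≤-trans (ℚ.<⇒≤ (small n (ℕ.m⊔n≤o⇒n≤o 15 N n≥))) (≤-by (ℚ.<⇒≤ ε′>0) refl))
  where
  open Estimates
  bound : ∃[ N ] (∀ n → N ℕ.≤ n → ι 70 ℚ.* recip n ℚ.< ε)
  bound = recip-small (ι 70) ε ε>0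
  N : ℕ
  N = proj₁ bound
  small : ∀ n → N ℕ.≤ n → ι 70 ℚ.* recip n ℚ.< ε
  small = proj₂ bound
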